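{- Let $\varepsilon>\frac{5}{6}$. If $A\subseteq\{0,1\}^*$ is $\varepsilon'^{11}$-rich for some $\varepsilon'<\varepsilon$, then $H=\Omega_3(A)$ is an $\varepsilon$-hitting set for the class of read-once branching programs of width $3$.
   Context: A branching program $P$ on Boolean variables $x_1,\ldots,x_n$ is a directed acyclic multigraph with one source; every non-sink node has out-degree 2, is labeled by a variable $x_i$, and its two outgoing edges are labeled $0$ and $1$; sinks are labeled $0$ or $1$. On input $\mathbf{a}\in\{0,1\}^n$ the computation starts at the source and at a node labeled $x_i$ follows the edge labeled $a_i$ until a sink is reached; the sink's label is $P(\mathbf{a})$. $P$ is read-once if every variable is queried at most once along each computational path. Programs are leveled: the nodes are partitioned into levels, the source forms level $0$, edges go only from level $k$ to level $k+1$, and the last level consists of all sinks; the width is the maximum number of nodes on a level. A set $H\subseteq\{0,1\}^*$ is an $\varepsilon$-hitting set for a class $\mathcal P$ if for all sufficiently large $n$, for every $P\in\mathcal P$ on $n$ variables, $|P^{ -1}(1)|/2^n\geq\varepsilon$ implies there is $\mathbf{a}\in H\cap\{0,1\}^n$ with $P(\mathbf{a})=1$. For $\eta>0$, a set $A\subseteq\{0,1\}^*$ is $\eta$-rich if for all sufficiently large $n$, for every index set $I\subseteq\{1,\ldots,n\}$, every partition $\{R_1,\ldots,R_r\}$ of $I$ ($r\geq0$) with $\prod_{j=1}^r(1-2^{ -|R_j|})\geq\eta$, every $Q\subseteq\{1,\ldots,n\}\setminus I$ with $|Q|\leq\log_2 n$, and every $\mathbf{c}\in\{0,1\}^n$,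 there exists $\mathbf{a}\in A\cap\{0,1\}^n$ with $a_i=c_i$ for all $i\in Q$ and, for every $j\in\{1,\ldots,r\}$, some $i\in R_j$ with $a_i\neq c_i$. For $\mathbf{a}\in\{0,1\}^n$, $\Omega_c(\mathbf{a})=\{\mathbf{a}'\in\{0,1\}^n: h(\mathbf{a},\mathbf{a}')\leq c\}$ where $h$ is Hamming distance, and $\Omega_c(A)=\bigcup_{\mathbf{a}\in A}\Omega_c(\mathbf{a})$. -}

module Defs where

open import Data.Bool using (Bool; true; false; if_then_else_; _xor_)
open import Data.Nat using (ℕ; zero; suc; _+_; _^_)
open import Data.Nat.Logarithm using (⌊log₂_⌋)
open import Data.Fin using (Fin)
import Data.Fin as Fin
open import Data.Fin.Subset using (Subset; _∈_; _∉_; ∣_∣; Nonempty)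
open import Data.Vec.Functional using () renaming (_∷_ to _∷ᶠ_)
open import Data.List using (List; []; _∷_)
open import Data.List.Relation.Unary.All using (All)
open import Data.List.Relation.Unary.AllPairs using (AllPairs)
open import Data.List.Relation.Unary.Unique.Propositional using (Unique)
open import Data.Integer using (+_)
open import Data.Rational using (ℚ; 1ℚ; ½; _*_; _-_; _/_) renaming (_≤_ to _≤ℚ_)
import Data.Nat
open import Data.Product using (Σ; ∃; _×_)
open import Relation.Binary.PropositionalEquality using (_≡_)

-- Words of {0,1}^n are functions Fin n → Bool (variable x_{i+1} ↦ index i).
-- A language A ⊆ {0,1}^* is a family of predicates, one per length n.

Word : ℕ → Set
Word n = Fin n → Bool

Lang : Set₁
Lang = (n : ℕ) → Word n → Set

count : {n : ℕ} → (Fin n → Bool) → ℕ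
count {zero}  f = 0
count {suc n} f = (if f Fin.zero then 1 else 0) + count (λ i → f (Fin.suc i))

hamming : {n : ℕ} → Word n → Word n → ℕ
hamming a b = count (λ i → a i xor b i)

Ω : ℕ → Lang → Lang
Ω c A n b = ∃ λ (a : Word n) → A n a × hamming a b Data.Nat.≤ c

numSat : {n : ℕ} → (Word n → Bool) → ℕ
numSat {zero}  g = if g (λ ()) then 1 else 0
numSat {suc n} g = numSat (λ f → g (true ∷ᶠ f)) + numSat (λ f → g (false ∷ᶠ f))

ℕtoℚ : ℕ → ℚ
ℕtoℚ k = + k / 1

powℚ : ℚ → ℕ → ℚ
powℚ q zero    = 1ℚ
powℚ q (suc k) = q * powℚ q k

pow2inv : ℕ → ℚ
pow2inv k = powℚ ½ k

prodBlocks : {n : ℕ} → List (Subset n) → ℚ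
prodBlocks []       = 1ℚ
prodBlocks (R ∷ Rs) = (1ℚ - pow2inv ∣ R ∣) * prodBlocks Rs

-- Leveled branching programs.
-- Layers n w : the part of a leveled program on n variables starting at a
-- level with w nodes (Fin w).  Either that level is the last one (all sinks,
-- each labelled by a Bool), or every node of the level is labelled by a
-- variable and has a 0-edge and a 1-edge into the next level of width w'.

data Layers (n : ℕ) : ℕ → Set where
  sinks : {w : ℕ} → (Fin w → Bool) → Layers n w
  layer : {w w' : ℕ} → (Fin w → Fin n) → (Fin w → Bool → Fin w') →
          Layers n w' → Layers n w

-- A branching program: the source forms level 0 (a single node).
BP : ℕ → Set
BP n = Layers n 1

WidthLE : {n w : ℕ} → ℕ → Layers n w → Set
WidthLE {w = w} k (sinks _)     = w Data.Nat.≤ k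
WidthLE {w = w} k (layer _ _ L) = w Data.Nat.≤ k × WidthLE k L

evalFrom : {n w : ℕ} → Layers n w → Fin w → Word n → Bool
evalFrom (sinks out)           v a = out v
evalFrom (layer var next L)    v a = evalFrom L (next v (a (var v))) a

queried : {n w : ℕ} → Layers n w → Fin w → Word n → List (Fin n)
queried (sinks out)        v a = []
queried (layer var next L) v a = var v ∷ queried L (next v (a (var v))) a

eval : {n : ℕ} → BP n → Word n → Bool
eval P a = evalFrom P Fin.zero a

ReadOnce : {n : ℕ} → BP n → Set
ReadOnce P = ∀ a → Unique (queried P Fin.zero a)

ROBP3 : {n : ℕ} → BP n → Set
ROBP3 P = ReadOnce P × WidthLE 3 P

HittingROBP3 : ℚ → Lang → Set
HittingROBP3 ε H =
  ∃ λ (N : ℕ) → ∀ n → N Data.Nat.≤ n → (P : BP n) → ROBP3 P →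
    ε * ℕtoℚ (2 ^ n) ≤ℚ ℕtoℚ (numSat (eval P)) →
    ∃ λ (a : Word n) → H n a × eval P a ≡ true

-- η-rich sets.
-- A partition {R_1,…,R_r} of I is a list of nonempty, pairwise disjoint
-- subsets of Fin n; I is their union (so it need not be given separately).
-- Q ⊆ {1..n} \ I means Q is disjoint from every block.
-- |Q| ≤ log₂ n  (|Q| a natural number) is |Q| ≤ ⌊log₂ n⌋.

Disjoint : {n : ℕ} → Subset n → Subset n → Set
Disjoint R S = ∀ i → i ∈ R → i ∉ S

Rich : ℚ → Lang → Set
Rich η A =
  ∃ λ (N : ℕ) → ∀ n → N Data.Nat.≤ n →
    (Rs : List (Subset n)) → All Nonempty Rs → AllPairs Disjoint Rs →
    η ≤ℚ prodBlocks Rs →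
    (Q : Subset n) → All (Disjoint Q) Rs → ∣ Q ∣ Data.Nat.≤ ⌊log₂ n ⌋ →
    (c : Word n) →
    ∃ λ (a : Word n) → A n a
      × (∀ i → i ∈ Q → a i ≡ c i)
      × All (λ R → ∃ λ i → i ∈ R × a i ≡ Data.Bool.not (c i)) Rs

-- The program is unfolded into read-once decision trees, three per level, and
-- processed from the sinks towards the source.  On each level one tree is bad
-- (it accepts with negligible probability), one is good (every word breaking
-- the clauses collected so far is accepted from it), and the third one may be
-- the end of a chain: a path that leaves for the good tree unless a pending
-- clause R is followed to its end, and that reaches the good tree if a term T is
-- obeyed.  One level up, either every node has an edge into the good tree or the
-- chain, and then a single deviation leads there from anywhere, or some node has
-- both edges into the bad tree and the other two take over the remaining roles.
-- If both of them lose acceptance probability, the pending clause is committed;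
-- it decreases the maximal acceptance probability m of the level by a factor
-- whose 11th power is at most 1 - 2^-|R|, so m^11 bounds the product over all
-- clauses.  A term of length log n cannot grow further: its chain accepts with
-- probability about 1/n and is declared bad.
-- The term need not be disjoint from the clause committed last.  That clause is
-- therefore left out in the end, at the price of one more deviation.

module Submission where

open import Defs
open import Data.Integer using (+_)
open import Data.Rational using (ℚ; _/_; _<_)
open import Data.Bool using (Bool; true; false; not; if_then_else_; _xor_)
open import Data.Bool.Properties using (not-involutive; xor-same)
open import Data.Empty using (⊥-elim)
open import Data.Fin using (Fin; zero; suc)
import Data.Fin.Properties as Fin
open import Data.Fin.Subset using (Subset; ⁅_⁆; _∪_; ∣_∣; ⊥; Nonempty) renaming (_∈_ to _∈ˢ_; _∉_ to _∉ˢ_)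
open import Data.Fin.Subset.Properties using (∪-identityˡ; ∣⊥∣≡0; x∈p∪q⁺; x∈p∪q⁻; x∈⁅x⁆; x∈⁅y⁆⇒x≡y; ∉⊥; ∣p∣≤n)
import Data.Integer as ℤ
import Data.Integer.Properties as ℤ
open import Data.List using (List; []; _∷_; length; map; _++_; concat; foldr; drop)
open import Data.List.Membership.DecPropositional using (_∈?_)
open import Data.List.Membership.Propositional using (_∈_; _∉_)
open import Data.List.Membership.Propositional.Properties using (∈-map⁺; ∈-++⁺ˡ; ∈-++⁺ʳ)
open import Data.List.Properties using (map-++; length-map)
open import Data.List.Relation.Binary.Permutation.Propositional using (_↭_; ↭-refl; ↭-sym; ↭-trans; prep; swap)
open import Data.List.Relation.Binary.Permutation.Propositional.Properties using (∈-resp-↭)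
import Data.List.Relation.Unary.All as All
open import Data.List.Relation.Unary.All using (All; []; _∷_)
import Data.List.Relation.Unary.All.Properties as All
import Data.List.Relation.Unary.AllPairs as AllPairs
open import Data.List.Relation.Unary.AllPairs using (AllPairs; []; _∷_)
import Data.List.Relation.Unary.Any as Any
open import Data.List.Relation.Unary.Any using (Any; here; there)
open import Data.List.Relation.Unary.Unique.Propositional using (Unique)
open import Data.Nat as ℕ using (ℕ; zero; suc; z≤n; s≤s)
open import Data.Nat.Logarithm using (⌊log₂_⌋; ⌊log₂[2^n]⌋≡n; ⌊log₂⌋-mono-≤)
import Data.Nat.Properties as ℕ
import Data.Nat.Solver
open import Data.Product using (∃; _×_; _,_; proj₁; proj₂)
open import Data.Rational using (0ℚ; 1ℚ; ½; _+_; _*_; _-_; -_; _≤_; nonNegative; toℚᵘ; mkℚ; Positive; positive; ↧ₙ_)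
open import Data.Rational.Properties
open import Data.Rational.Solver using (module +-*-Solver)
import Data.Rational.Unnormalised as ℚᵘ
import Data.Rational.Unnormalised.Properties as ℚᵘ
open import Data.Sum using (_⊎_; inj₁; inj₂)
open import Data.Unit using (⊤; tt)
import Data.Vec as Vec
open import Data.Vec.Functional using (updateAt) renaming (_∷_ to _∷ᶠ_)
open import Data.Vec.Functional.Properties using (updateAt-updates; updateAt-minimal)
open import Function using (_∘_; const)
open import Relation.Binary.PropositionalEquality using (_≡_; _≢_; refl; sym; trans; cong; cong₂; subst; subst₂; module ≡-Reasoning)
open import Relation.Nullary using (¬_; yes; no; contradiction)
open import Relation.Nullary.Decidable using (toWitness)

open +-*-Solver using (solve; _:=_; _:+_; _:*_; _:-_; con)
module ℕS = Data.Nat.Solver.+-*-Solver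

-- Order arithmetic of the rationals and eleventh powers.

≤⇒0≤- : ∀ {p q} → p ≤ q → 0ℚ ≤ q - p
≤⇒0≤- {p} {q} p≤q = subst (_≤ q - p) (+-inverseʳ p) (+-monoˡ-≤ (- p) p≤q)

≤-from-difference : ∀ {p q s} → 0ℚ ≤ s → q - p ≡ s → p ≤ q
≤-from-difference {p} {q} {s} 0≤s eq = subst₂ _≤_ (+-identityˡ p)
  (trans (cong (_+ p) (sym eq)) (solve 2 (λ p q → (q :- p) :+ p := q) refl p q))
  (+-monoˡ-≤ p 0≤s)

0≤+ : ∀ {p q} → 0ℚ ≤ p → 0ℚ ≤ q → 0ℚ ≤ p + q
0≤+ 0≤p 0≤q = +-mono-≤ 0≤p 0≤q

0≤* : ∀ {p q} → 0ℚ ≤ p → 0ℚ ≤ q → 0ℚ ≤ p * q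
0≤* {p} {q} 0≤p 0≤q = nonNegative⁻¹ (p * q)
  {{nonNeg*nonNeg⇒nonNeg p {{nonNegative 0≤p}} q {{nonNegative 0≤q}}}}

*-mono-≤ : ∀ {p q r s} → 0ℚ ≤ p → 0ℚ ≤ s → p ≤ q → r ≤ s → p * r ≤ q * s
*-mono-≤ {p} {q} {r} {s} 0≤p 0≤s p≤q r≤s =
  ≤-trans (*-monoˡ-≤-nonNeg p {{nonNegative 0≤p}} r≤s) (*-monoʳ-≤-nonNeg s {{nonNegative 0≤s}} p≤q)

powℚ-nonneg : ∀ {p} k → 0ℚ ≤ p → 0ℚ ≤ powℚ p k
powℚ-nonneg zero    0≤p = toWitness {a? = 0ℚ ≤? 1ℚ} _
powℚ-nonneg (suc k) 0≤p = 0≤* 0≤p (powℚ-nonneg k 0≤p)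

powℚ-mono : ∀ {p q} k → 0ℚ ≤ p → p ≤ q → powℚ p k ≤ powℚ q k
powℚ-mono zero    0≤p p≤q = ≤-refl
powℚ-mono (suc k) 0≤p p≤q =
  *-mono-≤ 0≤p (powℚ-nonneg k (≤-trans 0≤p p≤q)) p≤q (powℚ-mono k 0≤p p≤q)

powℚ-distrib-* : ∀ p q k → powℚ (p * q) k ≡ powℚ p k * powℚ q k
powℚ-distrib-* p q zero    = refl
powℚ-distrib-* p q (suc k) = trans (cong (p * q *_) (powℚ-distrib-* p q k))
  (solve 4 (λ p q a b → p :* q :* (a :* b) := p :* a :* (q :* b)) refl p q (powℚ p k) (powℚ q k))

0≤square : ∀ p → 0ℚ ≤ p * p
0≤square p with ≤-total 0ℚ p
... | inj₁ 0≤p = 0≤* 0≤p 0≤p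
... | inj₂ p≤0 = subst (0ℚ ≤_)
  (solve 1 (λ p → (con 0ℚ :- p) :* (con 0ℚ :- p) := p :* p) refl p)
  (0≤* (≤⇒0≤- p≤0) (≤⇒0≤- p≤0))

-- The exponent is odd: for negative `p` the power is `p` times a square, hence at most 0. The case
-- arises because `ε′` may be negative.
powℚ-11-mono : ∀ {p q} → 0ℚ ≤ q → p ≤ q → powℚ p 11 ≤ powℚ q 11
powℚ-11-mono {p} {q} 0≤q p≤q with ≤-total 0ℚ p
... | inj₁ 0≤p = powℚ-mono 11 0≤p p≤q
... | inj₂ p≤0 = ≤-trans
  (≤-from-difference (0≤* (≤⇒0≤- p≤0) (0≤square (powℚ p 5)))
    (trans (cong (λ r → 0ℚ - p * r) (split p))
           (solve 2 (λ p r → con 0ℚ :- p :* (r :* r) := (con 0ℚ :- p) :* (r :* r)) refl p (powℚ p 5))))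
  (powℚ-nonneg 11 0≤q)
  where
  split : ∀ p → powℚ p 10 ≡ powℚ p 5 * powℚ p 5
  split = solve 1 (λ p → p :* (p :* (p :* (p :* (p :* (p :* (p :* (p :* (p :* (p :* con 1ℚ)))))))))
    := (p :* (p :* (p :* (p :* (p :* con 1ℚ))))) :* (p :* (p :* (p :* (p :* (p :* con 1ℚ)))))) refl

pow2inv-nonneg : ∀ k → 0ℚ ≤ pow2inv k
pow2inv-nonneg k = powℚ-nonneg k (toWitness {a? = 0ℚ ≤? ½} _)

pow2inv≤1 : ∀ k → pow2inv k ≤ 1ℚ
pow2inv≤1 zero    = ≤-refl
pow2inv≤1 (suc k) = ≤-trans
  (*-mono-≤ (toWitness {a? = 0ℚ ≤? ½} _) (toWitness {a? = 0ℚ ≤? 1ℚ} _) (toWitness {a? = ½ ≤? 1ℚ} _) (pow2inv≤1 k))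
  ≤-refl

-- A chain node with a pending clause of size r accepts with probability at most
-- keep r * m.  The true factor on a fixed level is 1 - 2^-r / 2; the constant 3/8
-- leaves room for m to shrink when a clause is committed.
keep : ℕ → ℚ
keep r = 1ℚ - (+ 3 / 8) * pow2inv r

-- Three of the eleven factors are bounded by 1. The other eight come from squaring three times,
-- with the linear bounds 1 - 11t/2, 1 - 10t and 1 - 16t for the second, fourth and eighth power; t
-- ≤ 1/32 absorbs the quadratic terms.
eleventh-power-bound : ∀ t → 0ℚ ≤ t → t ≤ + 1 / 32 → powℚ (1ℚ - (+ 3 / 1) * t) 11 ≤ 1ℚ - (+ 16 / 1) * t
eleventh-power-bound t 0≤t t≤ = begin
  powℚ u 11                 ≡⟨ split u ⟩
  u³ * u⁸                   ≤⟨ *-mono-≤ (powℚ-nonneg 3 0≤u) 0≤u⁸ (powℚ-mono 3 0≤u u≤1) ≤-refl ⟩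
  1ℚ * u⁸                   ≡⟨ *-identityˡ u⁸ ⟩
  u⁸                        ≤⟨ sq {(u * u) * (u * u)} (0≤square (u * u)) (sq {u * u} (0≤square u) step₁ step₂) step₃ ⟩
  1ℚ - (+ 16 / 1) * t       ∎
  where
  open ≤-Reasoning
  u  = 1ℚ - (+ 3 / 1) * t
  u³ = powℚ u 3
  u⁸ = ((u * u) * (u * u)) * ((u * u) * (u * u))
  0≤u⁸ = 0≤square ((u * u) * (u * u))
  0≤32 : 0ℚ ≤ (+ 1 / 32) - t
  0≤32 = ≤⇒0≤- t≤
  0≤q : ∀ q {pr : _} → 0ℚ ≤ q
  0≤q q {pr} = toWitness {a? = 0ℚ ≤? q} pr
  0≤u : 0ℚ ≤ u
  0≤u = ≤-from-difference (0≤+ (0≤* (0≤q (+ 3 / 1)) 0≤32) (0≤q (+ 29 / 32)))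
    (solve 1 (λ t → (con 1ℚ :- con (+ 3 / 1) :* t) :- con 0ℚ
      := con (+ 3 / 1) :* (con (+ 1 / 32) :- t) :+ con (+ 29 / 32)) refl t)
  u≤1 : u ≤ 1ℚ
  u≤1 = ≤-from-difference (0≤* (0≤q (+ 3 / 1)) 0≤t)
    (solve 1 (λ t → con 1ℚ :- (con 1ℚ :- con (+ 3 / 1) :* t) := con (+ 3 / 1) :* t) refl t)
  sq : ∀ {p q r} → 0ℚ ≤ p → p ≤ q → q * q ≤ r → p * p ≤ r
  sq 0≤p p≤q q²≤r = ≤-trans (*-mono-≤ 0≤p (≤-trans 0≤p p≤q) p≤q p≤q) q²≤r
  v₁ = 1ℚ - (+ 11 / 2) * t
  v₂ = 1ℚ - (+ 10 / 1) * t
  step₁ : u * u ≤ v₁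
  step₁ = ≤-from-difference (0≤* 0≤t (0≤+ (0≤* (0≤q (+ 9 / 1)) 0≤32) (0≤q (+ 7 / 32))))
    (solve 1 (λ t → (con 1ℚ :- con (+ 11 / 2) :* t) :- (con 1ℚ :- con (+ 3 / 1) :* t) :* (con 1ℚ :- con (+ 3 / 1) :* t)
      := t :* (con (+ 9 / 1) :* (con (+ 1 / 32) :- t) :+ con (+ 7 / 32))) refl t)
  step₂ : v₁ * v₁ ≤ v₂
  step₂ = ≤-from-difference (0≤* 0≤t (0≤+ (0≤* (0≤q (+ 121 / 4)) 0≤32) (0≤q (+ 7 / 128))))
    (solve 1 (λ t → (con 1ℚ :- con (+ 10 / 1) :* t) :- (con 1ℚ :- con (+ 11 / 2) :* t) :* (con 1ℚ :- con (+ 11 / 2) :* t)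
      := t :* (con (+ 121 / 4) :* (con (+ 1 / 32) :- t) :+ con (+ 7 / 128))) refl t)
  step₃ : v₂ * v₂ ≤ 1ℚ - (+ 16 / 1) * t
  step₃ = ≤-from-difference (0≤* 0≤t (0≤+ (0≤* (0≤q (+ 100 / 1)) 0≤32) (0≤q (+ 7 / 8))))
    (solve 1 (λ t → (con 1ℚ :- con (+ 16 / 1) :* t) :- (con 1ℚ :- con (+ 10 / 1) :* t) :* (con 1ℚ :- con (+ 10 / 1) :* t)
      := t :* (con (+ 100 / 1) :* (con (+ 1 / 32) :- t) :+ con (+ 7 / 8))) refl t)
  split : ∀ u → powℚ u 11 ≡ powℚ u 3 * (((u * u) * (u * u)) * ((u * u) * (u * u)))
  split = solve 1 (λ p → p :* (p :* (p :* (p :* (p :* (p :* (p :* (p :* (p :* (p :* (p :* con 1ℚ))))))))))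
    := (p :* (p :* (p :* con 1ℚ))) :* (((p :* p) :* (p :* p)) :* ((p :* p) :* (p :* p)))) refl

-- For t = 2^-r / 32 the two sides are (1 - 3t)^11 and 1 - 16t. A clause of length `suc r` is
-- committed at one further query, hence the index `suc (suc r)`.
keep-11 : ∀ r → powℚ (keep (suc (suc r))) 11 ≤ 1ℚ - pow2inv (suc r)
keep-11 r = subst₂ (λ p q → powℚ p 11 ≤ q)
  (solve 1 (λ x → con 1ℚ :- con (+ 3 / 1) :* (con (+ 1 / 32) :* x) := con 1ℚ :- con (+ 3 / 8) :* (con ½ :* (con ½ :* x))) refl (pow2inv r))
  (solve 1 (λ x → con 1ℚ :- con (+ 16 / 1) :* (con (+ 1 / 32) :* x) := con 1ℚ :- con ½ :* x) refl (pow2inv r))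
  (eleventh-power-bound ((+ 1 / 32) * pow2inv r)
    (0≤* (toWitness {a? = 0ℚ ≤? (+ 1 / 32)} _) (pow2inv-nonneg r))
    (subst ((+ 1 / 32) * pow2inv r ≤_) (*-identityʳ (+ 1 / 32))
      (*-monoˡ-≤-nonNeg (+ 1 / 32) {{_}} (pow2inv≤1 r))))

-- Read-once decision trees.

data Tree (n : ℕ) : Set where
  leaf : Bool → Tree n
  node : Fin n → (Bool → Tree n) → Tree n

module _ {n : ℕ} where

  run : Tree n → Word n → Bool
  run (leaf b)   a = b
  run (node x c) a = run (c (a x)) a

  queries : Tree n → Word n → List (Fin n)
  queries (leaf b)   a = []
  queries (node x c) a = x ∷ queries (c (a x)) a

  acceptance : Tree n → ℚ
  acceptance (leaf b)   = if b then 1ℚ else 0ℚ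
  acceptance (node x c) = ½ * (acceptance (c true) + acceptance (c false))

  data _Occurs_ (i : Fin n) : Tree n → Set where
    here  : ∀ {c} → i Occurs node i c
    there : ∀ {x c} d → i Occurs c d → i Occurs node x c

  ReadOnceTree : Tree n → Set
  ReadOnceTree (leaf b)   = ⊤
  ReadOnceTree (node x c) = ∀ d → ¬ x Occurs c d × ReadOnceTree (c d)

  -- A certificate for a path to an accepting leaf, with `k` bounding the edges taken against `a`.
  -- It speaks of paths, so it is composed node by node from the children; a nearby word is
  -- extracted only at the end, by `Hits⇒run`.
  data Hits (a : Word n) : ℕ → Tree n → Set where
    accept  : ∀ {k} → Hits a k (leaf true)
    follow  : ∀ {k x c} → Hits a k (c (a x)) → Hits a k (node x c)
    deviate : ∀ {k x c} d → Hits a k (c d) → Hits a (suc k) (node x c)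

  Hits-weaken : ∀ {a k t} → Hits a k t → Hits a (suc k) t
  Hits-weaken accept        = accept
  Hits-weaken (follow h)    = follow (Hits-weaken h)
  Hits-weaken (deviate d h) = deviate d (Hits-weaken h)

  infixl 9 _[_≔_]
  _[_≔_] : Word n → Fin n → Bool → Word n
  a [ x ≔ d ] = updateAt a x (const d)

  [≔]-same : ∀ a x d → (a [ x ≔ d ]) x ≡ d
  [≔]-same a x d = updateAt-updates x a

  [≔]-other : ∀ a x d {i} → i ≢ x → (a [ x ≔ d ]) i ≡ a i
  [≔]-other a x d {i} = updateAt-minimal i x a

  run-cong : ∀ t {a b} → (∀ {i} → i Occurs t → a i ≡ b i) → run t a ≡ run t b
  run-cong (leaf b)   a≗b = refl
  run-cong (node x c) {a} {b} a≗b rewrite a≗b here = run-cong (c (b x)) (a≗b ∘ there (b x))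

  queries-cong : ∀ t {a b} → (∀ {i} → i Occurs t → a i ≡ b i) → queries t a ≡ queries t b
  queries-cong (leaf b)   a≗b = refl
  queries-cong (node x c) {a} {b} a≗b rewrite a≗b here =
    cong (x ∷_) (queries-cong (c (b x)) (a≗b ∘ there (b x)))

  Occurs⇒≢ : ∀ {t x i} → ¬ x Occurs t → i Occurs t → i ≢ x
  Occurs⇒≢ x∉t i∈t refl = x∉t i∈t

  queries-[≔] : ∀ t a x d → x ∉ queries t (a [ x ≔ d ]) → queries t (a [ x ≔ d ]) ≡ queries t a
  queries-[≔] (leaf b)   a x d x∉ = refl
  queries-[≔] (node y c) a x d x∉ with y Fin.≟ x
  ... | yes refl = contradiction (here refl) x∉
  ... | no  y≢x rewrite [≔]-other a x d y≢x = cong (y ∷_) (queries-[≔] (c (a y)) a x d (x∉ ∘ there))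

  -- Setting `x` so as to enter the right child cannot disturb the path below, because `x` does not
  -- recur there.
  Occurs⇒queried : ∀ {t i} → ReadOnceTree t → i Occurs t → ∃ λ a → i ∈ queries t a
  Occurs⇒queried ro here = const false , here refl
  Occurs⇒queried {node x c} ro (there d occ) with Occurs⇒queried (proj₂ (ro d)) occ
  ... | a , i∈ = b , there (subst (_ ∈_) eq i∈)
    where
    b = a [ x ≔ d ]
    eq : queries (c d) a ≡ queries (c (b x)) b
    eq rewrite [≔]-same a x d =
      queries-cong (c d) λ occ′ → sym ([≔]-other a x d (Occurs⇒≢ (proj₁ (ro d)) occ′))

  -- `Unique` speaks of computations, `ReadOnceTree` of the whole tree. A word entering child `d`
  -- does not query `x` again, so its bit at `x` is free and every word queries distinct variables
  -- in that child. By induction the child is read-once, and then an occurrence of `x` in it would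
  -- be queried by some word.
  unique⇒readOnce : ∀ t → (∀ a → Unique (queries t a)) → ReadOnceTree t
  unique⇒readOnce (leaf b)   uniq   = tt
  unique⇒readOnce (node x c) uniq d = x∉c , roc
    where
    uniq-d : ∀ a → Unique (x ∷ queries (c d) (a [ x ≔ d ]))
    uniq-d a = subst (λ e → Unique (x ∷ queries (c e) (a [ x ≔ d ]))) ([≔]-same a x d) (uniq (a [ x ≔ d ]))
    x∉ : ∀ a → x ∉ queries (c d) (a [ x ≔ d ])
    x∉ a x∈ = All.lookup (AllPairs.head (uniq-d a)) x∈ refl
    unchanged : ∀ a → queries (c d) (a [ x ≔ d ]) ≡ queries (c d) a
    unchanged a = queries-[≔] (c d) a x d (x∉ a)
    roc : ReadOnceTree (c d)
    roc = unique⇒readOnce (c d) λ a → subst Unique (unchanged a) (AllPairs.tail (uniq-d a))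
    x∉c : ¬ x Occurs c d
    x∉c occ with Occurs⇒queried roc occ
    ... | a , x∈ = x∉ a (subst (x ∈_) (sym (unchanged a)) x∈)

-- Hamming distance, and words close to deviating paths.

count-cong : ∀ {n} {f g : Fin n → Bool} → (∀ i → f i ≡ g i) → count f ≡ count g
count-cong {zero}  f≗g = refl
count-cong {suc n} f≗g rewrite f≗g zero = cong (_ ℕ.+_) (count-cong (f≗g ∘ suc))

hamming-refl : ∀ {n} (a : Word n) → hamming a a ≡ 0
hamming-refl {zero}  a = refl
hamming-refl {suc n} a rewrite xor-same (a zero) = hamming-refl (a ∘ suc)

hamming-[≔] : ∀ {n} (a b : Word n) x d → hamming a (b [ x ≔ d ]) ℕ.≤ suc (hamming a b)
hamming-[≔] a b zero    d = ℕ.+-mono-≤ (bit≤1 (a zero xor d)) (ℕ.m≤n+m _ _)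
  where
  bit≤1 : ∀ e → (if e then 1 else 0) ℕ.≤ 1
  bit≤1 true  = ℕ.≤-refl
  bit≤1 false = z≤n
hamming-[≔] a b (suc x) d = ℕ.≤-trans
  (ℕ.+-monoʳ-≤ (if a zero xor b zero then 1 else 0) (hamming-[≔] (a ∘ suc) (b ∘ suc) x d))
  (ℕ.≤-reflexive (ℕ.+-suc _ _))

-- The bits deviated from are overwritten from the leaf upwards. The last component carries the
-- induction: only variables of the subtree change, so the bit that directs the path at the node
-- above is intact.
Hits⇒run : ∀ {n} {a : Word n} {k} t → ReadOnceTree t → Hits a k t →
  ∃ λ b → run t b ≡ true × hamming a b ℕ.≤ k × (∀ {i} → ¬ i Occurs t → b i ≡ a i)
Hits⇒run {a = a} _ ro accept = a , refl , ℕ.≤-trans (ℕ.≤-reflexive (hamming-refl a)) z≤n , λ _ → refl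
Hits⇒run {a = a} (node x c) ro (follow h) with Hits⇒run (c (a x)) (proj₂ (ro (a x))) h
... | b , run≡ , close , same =
  b , trans (cong (λ d → run (c d) b) (same (proj₁ (ro (a x))))) run≡ , close , λ i∉ → same (i∉ ∘ there (a x))
Hits⇒run {a = a} (node x c) ro (deviate d h) with Hits⇒run (c d) (proj₂ (ro d)) h
... | b , run≡ , close , same =
  b [ x ≔ d ] , trans run≡′ run≡ , ℕ.≤-trans (hamming-[≔] a b x d) (s≤s close) ,
  λ {i} i∉ → trans ([≔]-other b x d (λ { refl → i∉ here })) (same (i∉ ∘ there d))
  where
  run≡′ : run (node x c) (b [ x ≔ d ]) ≡ run (c d) b
  run≡′ rewrite [≔]-same b x d = run-cong (c d) λ occ → [≔]-other b x d (Occurs⇒≢ (proj₁ (ro d)) occ)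

-- Counting accepted words by acceptance probability.

numSat-cong : ∀ {n} {f g : Word n → Bool} → (∀ a → f a ≡ g a) → numSat f ≡ numSat g
numSat-cong {zero}  f≗g = cong (if_then 1 else 0) (f≗g _)
numSat-cong {suc n} f≗g = cong₂ ℕ._+_ (numSat-cong (f≗g ∘ (true ∷ᶠ_))) (numSat-cong (f≗g ∘ (false ∷ᶠ_)))

Extensional : ∀ {n} → (Word n → Bool) → Set
Extensional f = ∀ {a b} → (∀ i → a i ≡ b i) → f a ≡ f b

-- A restriction ignores the bit at `x`, so it counts every word of its half twice; hence the factor
-- 2. Extensionality is there because updated words coincide only pointwise.
numSat-split : ∀ {n} (f : Word n → Bool) → Extensional f → ∀ x →
  2 ℕ.* numSat f ≡ numSat (λ a → f (a [ x ≔ true ])) ℕ.+ numSat (λ a → f (a [ x ≔ false ]))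
numSat-split {suc n} f ext zero = begin
  2 ℕ.* (t ℕ.+ u)              ≡⟨ rearrange t u ⟩
  (t ℕ.+ t) ℕ.+ (u ℕ.+ u)      ≡⟨ sym (cong₂ ℕ._+_ (cong₂ ℕ._+_ (at true true) (at true false)) (cong₂ ℕ._+_ (at false true) (at false false))) ⟩
  _ ∎
  where
  open ≡-Reasoning
  t = numSat (λ a → f (true ∷ᶠ a))
  u = numSat (λ a → f (false ∷ᶠ a))
  rearrange : ∀ t u → 2 ℕ.* (t ℕ.+ u) ≡ (t ℕ.+ t) ℕ.+ (u ℕ.+ u)
  rearrange = ℕS.solve 2 (λ t u → ℕS.con 2 ℕS.:* (t ℕS.:+ u) ℕS.:= (t ℕS.:+ t) ℕS.:+ (u ℕS.:+ u)) refl
  at : ∀ d e → numSat (λ a → f ((e ∷ᶠ a) [ zero ≔ d ])) ≡ numSat (λ a → f (d ∷ᶠ a))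
  at d e = numSat-cong λ a → ext {(e ∷ᶠ a) [ zero ≔ d ]} {d ∷ᶠ a} λ { zero → refl ; (suc i) → refl }
numSat-split {suc n} f ext (suc x) = begin
  2 ℕ.* (t ℕ.+ u)              ≡⟨ ℕ.*-distribˡ-+ 2 t u ⟩
  2 ℕ.* t ℕ.+ 2 ℕ.* u          ≡⟨ cong₂ ℕ._+_ (numSat-split _ (ext′ true) x) (numSat-split _ (ext′ false) x) ⟩
  (s true true ℕ.+ s false true) ℕ.+ (s true false ℕ.+ s false false)
                               ≡⟨ rearrange (s true true) (s false true) (s true false) (s false false) ⟩
  (s true true ℕ.+ s true false) ℕ.+ (s false true ℕ.+ s false false)
                               ≡⟨ cong₂ ℕ._+_ (cong₂ ℕ._+_ (at true true) (at true false)) (cong₂ ℕ._+_ (at false true) (at false false)) ⟩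
  _ ∎
  where
  open ≡-Reasoning
  t = numSat (λ a → f (true ∷ᶠ a))
  u = numSat (λ a → f (false ∷ᶠ a))
  s : Bool → Bool → ℕ
  s d e = numSat (λ a → f (e ∷ᶠ (a [ x ≔ d ])))
  ext′ : ∀ e → Extensional (λ a → f (e ∷ᶠ a))
  ext′ e a≗b = ext λ { zero → refl ; (suc i) → a≗b i }
  rearrange : ∀ a b c d → (a ℕ.+ b) ℕ.+ (c ℕ.+ d) ≡ (a ℕ.+ c) ℕ.+ (b ℕ.+ d)
  rearrange = ℕS.solve 4 (λ a b c d → (a ℕS.:+ b) ℕS.:+ (c ℕS.:+ d) ℕS.:= (a ℕS.:+ c) ℕS.:+ (b ℕS.:+ d)) refl
  at : ∀ d e → s d e ≡ numSat (λ a → f ((e ∷ᶠ a) [ suc x ≔ d ]))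
  at d e = numSat-cong λ a → ext {e ∷ᶠ (a [ x ≔ d ])} {(e ∷ᶠ a) [ suc x ≔ d ]} λ { zero → refl ; (suc i) → refl }

ℕtoℚ-+ : ∀ a b → ℕtoℚ (a ℕ.+ b) ≡ ℕtoℚ a + ℕtoℚ b
ℕtoℚ-+ a b = toℚᵘ-injective (begin
  toℚᵘ (ℕtoℚ (a ℕ.+ b))                      ≈⟨ toℚᵘ-fromℚᵘ (ℚᵘ.mkℚᵘ (+ (a ℕ.+ b)) 0) ⟩
  ℚᵘ.mkℚᵘ (+ (a ℕ.+ b)) 0                     ≈⟨ ℚᵘ.*≡* (cong (ℤ._* + 1) (sym (cong₂ ℤ._+_ (ℤ.*-identityʳ (+ a)) (ℤ.*-identityʳ (+ b))))) ⟩
  ℚᵘ.mkℚᵘ (+ a) 0 ℚᵘ.+ ℚᵘ.mkℚᵘ (+ b) 0        ≈⟨ ℚᵘ.+-cong (ℚᵘ.≃-sym (toℚᵘ-fromℚᵘ (ℚᵘ.mkℚᵘ (+ a) 0))) (ℚᵘ.≃-sym (toℚᵘ-fromℚᵘ (ℚᵘ.mkℚᵘ (+ b) 0))) ⟩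
  toℚᵘ (ℕtoℚ a) ℚᵘ.+ toℚᵘ (ℕtoℚ b)            ≈⟨ ℚᵘ.≃-sym (toℚᵘ-homo-+ (ℕtoℚ a) (ℕtoℚ b)) ⟩
  toℚᵘ (ℕtoℚ a + ℕtoℚ b)                      ∎)
  where
  open ℚᵘ.≃-Reasoning

numSat-const : ∀ n b → ℕtoℚ (numSat {n} (const b)) ≡ ℕtoℚ (2 ℕ.^ n) * (if b then 1ℚ else 0ℚ)
numSat-const n true  = trans (cong ℕtoℚ (all n)) (sym (*-identityʳ (ℕtoℚ (2 ℕ.^ n))))
  where
  all : ∀ n → numSat {n} (const true) ≡ 2 ℕ.^ n
  all zero    = refl
  all (suc n) = cong₂ ℕ._+_ (all n) (trans (all n) (sym (ℕ.+-identityʳ _)))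
numSat-const n false = trans (cong ℕtoℚ (none n)) (sym (*-zeroʳ (ℕtoℚ (2 ℕ.^ n))))
  where
  none : ∀ n → numSat {n} (const false) ≡ 0
  none zero    = refl
  none (suc n) = cong₂ ℕ._+_ (none n) (none n)

numSat-run : ∀ {n} (t : Tree n) → ReadOnceTree t →
  ℕtoℚ (numSat (run t)) ≡ ℕtoℚ (2 ℕ.^ n) * acceptance t
numSat-run {n} (leaf b)   ro = numSat-const n b
numSat-run {n} (node x c) ro = begin
  N                             ≡⟨ solve 1 (λ N → N := con ½ :* (N :+ N)) refl N ⟩
  ½ * (N + N)                   ≡⟨ cong (½ *_) (begin
    N + N                          ≡⟨ sym (ℕtoℚ-+ m m) ⟩
    ℕtoℚ (m ℕ.+ m)                 ≡⟨ cong (λ k → ℕtoℚ (m ℕ.+ k)) (sym (ℕ.+-identityʳ m)) ⟩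
    ℕtoℚ (2 ℕ.* m)                 ≡⟨ cong ℕtoℚ (numSat-split (run (node x c)) (λ a≗b → run-cong (node x c) λ {i} _ → a≗b i) x) ⟩
    _                              ≡⟨ cong ℕtoℚ (cong₂ ℕ._+_ (numSat-cong (branch true)) (numSat-cong (branch false))) ⟩
    ℕtoℚ (m′ true ℕ.+ m′ false)    ≡⟨ ℕtoℚ-+ (m′ true) (m′ false) ⟩
    ℕtoℚ (m′ true) + ℕtoℚ (m′ false) ≡⟨ cong₂ _+_ (numSat-run (c true) (proj₂ (ro true))) (numSat-run (c false) (proj₂ (ro false))) ⟩
    E * acceptance (c true) + E * acceptance (c false) ∎) ⟩
  ½ * (E * acceptance (c true) + E * acceptance (c false))
    ≡⟨ solve 3 (λ E p q → con ½ :* (E :* p :+ E :* q) := E :* (con ½ :* (p :+ q))) refl E (acceptance (c true)) (acceptance (c false)) ⟩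
  E * acceptance (node x c)     ∎
  where
  open ≡-Reasoning
  m = numSat (run (node x c))
  m′ : Bool → ℕ
  m′ d = numSat (run (c d))
  N = ℕtoℚ m
  E = ℕtoℚ (2 ℕ.^ n)
  branch : ∀ d a → run (node x c) (a [ x ≔ d ]) ≡ run (c d) a
  branch d a rewrite [≔]-same a x d =
    run-cong (c d) λ occ → [≔]-other a x d (Occurs⇒≢ (proj₁ (ro d)) occ)

-- Clauses and terms, and richness in their language.

Literals : ℕ → Set
Literals n = List (Fin n × Bool)

module _ {n : ℕ} where

  Agrees : Word n → Literals n → Set
  Agrees a = All (λ l → a (proj₁ l) ≡ proj₂ l)

  -- The same kind of list serves as a term, to be obeyed, and as a clause, to be broken: a clause
  -- is recorded by the assignment that violates it.
  Breaks : Word n → Literals n → Set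
  Breaks a = Any (λ l → a (proj₁ l) ≡ not (proj₂ l))

  NonEmpty : Literals n → Set
  NonEmpty R = 0 ℕ.< length R

  _∈vars_ : Fin n → Literals n → Set
  i ∈vars ls = i ∈ map proj₁ ls

  Distinct : Literals n → Set
  Distinct ls = Unique (map proj₁ ls)

  weight : List (Literals n) → ℚ
  weight = foldr (λ R q → (1ℚ - pow2inv (length R)) * q) 1ℚ

  distinct-++⁻ˡ : ∀ R {S} → Distinct (R ++ S) → Distinct R
  distinct-++⁻ˡ []      u       = []
  distinct-++⁻ˡ (l ∷ R) {S} (x ∷ u) =
    All.++⁻ˡ (map proj₁ R) (subst (All _) (map-++ proj₁ R S) x) ∷ distinct-++⁻ˡ R u

  distinct-++⁻ʳ : ∀ R {S} → Distinct (R ++ S) → Distinct S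
  distinct-++⁻ʳ []      u       = u
  distinct-++⁻ʳ (l ∷ R) (_ ∷ u) = distinct-++⁻ʳ R u

  distinct-++-disjoint : ∀ R {S i} → Distinct (R ++ S) → i ∈vars R → ¬ i ∈vars S
  distinct-++-disjoint (l ∷ R) {S} (x ∷ u) (here refl) i∈S =
    All.lookup (All.++⁻ʳ (map proj₁ R) (subst (All _) (map-++ proj₁ R S) x)) i∈S refl
  distinct-++-disjoint (l ∷ R) (x ∷ u) (there i∈R) i∈S = distinct-++-disjoint R u i∈R i∈S

  vars : Literals n → Subset n
  vars = foldr (λ l S → ⁅ proj₁ l ⁆ ∪ S) ⊥

  ∈-vars⁺ : ∀ {ls i} → i ∈vars ls → i ∈ˢ vars ls
  ∈-vars⁺ {l ∷ ls} (here refl) = x∈p∪q⁺ (inj₁ (x∈⁅x⁆ _))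
  ∈-vars⁺ {l ∷ ls} (there i∈)  = x∈p∪q⁺ (inj₂ (∈-vars⁺ i∈))

  ∈-vars⁻ : ∀ ls {i} → i ∈ˢ vars ls → i ∈vars ls
  ∈-vars⁻ []       i∈ = contradiction i∈ ∉⊥
  ∈-vars⁻ (l ∷ ls) i∈ with x∈p∪q⁻ ⁅ proj₁ l ⁆ (vars ls) i∈
  ... | inj₁ i∈l  = here (x∈⁅y⁆⇒x≡y _ i∈l)
  ... | inj₂ i∈ls = there (∈-vars⁻ ls i∈ls)

  assign : Literals n → Word n
  assign []             = const false
  assign ((i , b) ∷ ls) = assign ls [ i ≔ b ]

  assign-agrees : ∀ ls → Distinct ls → Agrees (assign ls) ls
  assign-agrees []             u       = []
  assign-agrees ((i , b) ∷ ls) (x ∷ u) = [≔]-same (assign ls) i b ∷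
    All.zipWith (λ { (i≢ , eq) → trans ([≔]-other (assign ls) i b (i≢ ∘ sym)) eq }) (All.map⁻ x , assign-agrees ls u)

∣⁅i⁆∪S∣ : ∀ {n i} {S : Subset n} → i ∉ˢ S → ∣ ⁅ i ⁆ ∪ S ∣ ≡ suc ∣ S ∣
∣⁅i⁆∪S∣ {i = zero}  {true Vec.∷ S}  i∉ = contradiction Vec.here i∉
∣⁅i⁆∪S∣ {i = zero}  {false Vec.∷ S} i∉ = cong (suc ∘ ∣_∣) (∪-identityˡ S)
∣⁅i⁆∪S∣ {i = suc i} {true Vec.∷ S}  i∉ = cong suc (∣⁅i⁆∪S∣ (i∉ ∘ Vec.there))
∣⁅i⁆∪S∣ {i = suc i} {false Vec.∷ S} i∉ = ∣⁅i⁆∪S∣ (i∉ ∘ Vec.there)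

module _ {n : ℕ} where

  ∣vars∣ : ∀ (ls : Literals n) → Distinct ls → ∣ vars ls ∣ ≡ length ls
  ∣vars∣ []       u       = ∣⊥∣≡0 n
  ∣vars∣ (l ∷ ls) (x ∷ u) = trans
    (∣⁅i⁆∪S∣ λ i∈ → All.lookup x (∈-vars⁻ ls i∈) refl) (cong suc (∣vars∣ ls u))

  vars-disjoint-blocks : ∀ {S : Literals n} Rs → (∀ i → i ∈vars concat Rs → ¬ i ∈vars S) →
    All (Disjoint (vars S)) (map vars Rs)
  vars-disjoint-blocks []       d = []
  vars-disjoint-blocks {S} (R ∷ Rs) d =
    (λ i i∈S i∈R → d i (in-head i (∈-vars⁻ R i∈R)) (∈-vars⁻ S i∈S)) ∷
    vars-disjoint-blocks Rs (λ i → d i ∘ in-tail i)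
    where
    in-head : ∀ i → i ∈vars R → i ∈vars (R ++ concat Rs)
    in-head i i∈ = subst (i ∈_) (sym (map-++ proj₁ R (concat Rs))) (∈-++⁺ˡ i∈)
    in-tail : ∀ i → i ∈vars concat Rs → i ∈vars (R ++ concat Rs)
    in-tail i i∈ = subst (i ∈_) (sym (map-++ proj₁ R (concat Rs))) (∈-++⁺ʳ (map proj₁ R) i∈)

  blocks-disjoint : ∀ (Rs : List (Literals n)) → Distinct (concat Rs) → AllPairs Disjoint (map vars Rs)
  blocks-disjoint []       u = []
  blocks-disjoint (R ∷ Rs) u =
    vars-disjoint-blocks Rs (λ i i∈Rs i∈R → distinct-++-disjoint R u i∈R i∈Rs) ∷
    blocks-disjoint Rs (distinct-++⁻ʳ R u)

  blocks-nonempty : ∀ {Rs : List (Literals n)} → All NonEmpty Rs → All Nonempty (map vars Rs)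
  blocks-nonempty []             = []
  blocks-nonempty {(l ∷ R) ∷ Rs} (_ ∷ ne) = (proj₁ l , ∈-vars⁺ {ls = l ∷ R} (here refl)) ∷ blocks-nonempty ne

  prodBlocks-vars : ∀ (Rs : List (Literals n)) → Distinct (concat Rs) → prodBlocks (map vars Rs) ≡ weight Rs
  prodBlocks-vars []       u = refl
  prodBlocks-vars (R ∷ Rs) u = cong₂ (λ k q → (1ℚ - pow2inv k) * q)
    (∣vars∣ R (distinct-++⁻ˡ R u)) (prodBlocks-vars Rs (distinct-++⁻ʳ R u))

  agrees-at : ∀ {ls : Literals n} {c i} → Agrees c ls → i ∈vars ls →
    Any (λ l → proj₁ l ≡ i × proj₂ l ≡ c i) ls
  agrees-at (eq ∷ _)   (here refl) = here (refl , sym eq)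
  agrees-at (_  ∷ agr) (there i∈)  = there (agrees-at agr i∈)

  breaks-blocks : ∀ {a c : Word n} Rs → Agrees c (concat Rs) →
    All (λ R → ∃ λ i → i ∈ˢ R × a i ≡ not (c i)) (map vars Rs) → All (Breaks a) Rs
  breaks-blocks []       agr []                        = []
  breaks-blocks (R ∷ Rs) agr ((i , i∈ , a≡) ∷ breaks) =
    Any.map (λ { (refl , b≡) → trans a≡ (cong not (sym b≡)) })
      (agrees-at (All.++⁻ˡ R agr) (∈-vars⁻ R i∈)) ∷
    breaks-blocks Rs (All.++⁻ʳ R agr) breaks

RichAt : ℚ → Lang → ℕ → Set
RichAt η A n =
    (Rs : List (Subset n)) → All Nonempty Rs → AllPairs Disjoint Rs →
    η ≤ prodBlocks Rs →
    (Q : Subset n) → All (Disjoint Q) Rs → ∣ Q ∣ ℕ.≤ ⌊log₂ n ⌋ →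
    (c : Word n) →
    ∃ λ (a : Word n) → A n a
      × (∀ i → i ∈ˢ Q → a i ≡ c i)
      × All (λ R → ∃ λ i → i ∈ˢ R × a i ≡ not (c i)) Rs

-- The word `c` is chosen to obey the term and all literals of the clauses. Agreeing with it on the
-- variables of `T` is then obeying `T`, and differing from it somewhere in a block breaks that
-- clause.
rich-literals : ∀ {η A n} → RichAt η A n →
  ∀ Rs T → Distinct (T ++ concat Rs) → All NonEmpty Rs → length T ℕ.≤ ⌊log₂ n ⌋ → η ≤ weight Rs →
  ∃ λ a → A n a × All (Breaks a) Rs × Agrees a T
rich-literals {η} rich Rs T u ne T≤ η≤
  with rich (map vars Rs) (blocks-nonempty ne) (blocks-disjoint Rs uRs)
            (subst (η ≤_) (sym (prodBlocks-vars Rs uRs)) η≤)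
            (vars T) (vars-disjoint-blocks Rs λ i i∈Rs i∈T → distinct-++-disjoint T u i∈T i∈Rs)
            (subst (ℕ._≤ _) (sym (∣vars∣ T (distinct-++⁻ˡ T u))) T≤) (assign (T ++ concat Rs))
  where uRs = distinct-++⁻ʳ T u
... | a , a∈A , agree , breaks =
  a , a∈A , breaks-blocks Rs (All.++⁻ʳ T agr) breaks ,
  All.tabulate λ l∈ → trans (agree _ (∈-vars⁺ (∈-map⁺ proj₁ l∈))) (All.lookup (All.++⁻ˡ T agr) l∈)
  where agr = assign-agrees (T ++ concat Rs) u

-- Unfolding leveled programs into trees.

module _ {n : ℕ} where

  tree : ∀ {w} → Layers n w → Fin w → Tree n
  tree (sinks out)        v = leaf (out v)
  tree (layer var next P) v = node (var v) (λ d → tree P (next v d))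

  depth : ∀ {w} → Layers n w → ℕ
  depth (sinks out)        = 0
  depth (layer var next P) = suc (depth P)

  run-tree : ∀ {w} (P : Layers n w) v a → run (tree P v) a ≡ evalFrom P v a
  run-tree (sinks out)        v a = refl
  run-tree (layer var next P) v a = run-tree P (next v (a (var v))) a

  queries-tree : ∀ {w} (P : Layers n w) v a → queries (tree P v) a ≡ queried P v a
  queries-tree (sinks out)        v a = refl
  queries-tree (layer var next P) v a = cong (var v ∷_) (queries-tree P (next v (a (var v))) a)

  length-queried : ∀ {w} (P : Layers n w) v a → length (queried P v a) ≡ depth P
  length-queried (sinks out)        v a = refl
  length-queried (layer var next P) v a = cong suc (length-queried P (next v (a (var v))) a)

  -- Pigeonhole through subsets: the indices get a dummy bit so that the cardinality of `vars`
  -- applies.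
  unique-length : ∀ (is : List (Fin n)) → Unique is → length is ℕ.≤ n
  unique-length is u = subst (ℕ._≤ n) (trans (∣vars∣ ls (subst Unique (sym (firsts is)) u)) (length-map _ is)) (∣p∣≤n (vars ls))
    where
    ls = map (_, true) is
    firsts : ∀ is → map proj₁ (map (_, true) is) ≡ is
    firsts []       = refl
    firsts (i ∷ is) = cong (i ∷_) (firsts is)

  width≤ : ∀ {w k} (P : Layers n w) → WidthLE k P → w ℕ.≤ k
  width≤ (sinks out)        w≤         = w≤
  width≤ (layer var next P) (w≤ , _) = w≤

-- Narrow levels are padded by repetition; the node passed in rules out an empty level.
enumerate : ∀ {w} → w ℕ.≤ 3 → Fin w → ∃ λ a → ∃ λ b → ∃ λ c → ∀ (v : Fin w) → v ∈ a ∷ b ∷ c ∷ []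
enumerate {1} _ _ = zero , zero , zero , λ { zero → here refl }
enumerate {2} _ _ = zero , suc zero , zero , λ { zero → here refl ; (suc zero) → there (here refl) }
enumerate {3} _ _ = zero , suc zero , suc (suc zero) ,
  λ { zero → here refl ; (suc zero) → there (here refl) ; (suc (suc zero)) → there (there (here refl)) }
enumerate {suc (suc (suc (suc w)))} (s≤s (s≤s (s≤s ()))) _

-- Nodes that are not reached are replaced by copies of a reached node, so that
-- every level consists of exactly three read-once trees.
cover : ∀ {w} → w ℕ.≤ 3 → ∀ {v₀} (vs : List (Fin w)) → v₀ ∈ vs →
  ∃ λ a → ∃ λ b → ∃ λ c → All (_∈ vs) (a ∷ b ∷ c ∷ []) × (∀ {v} → v ∈ vs → v ∈ a ∷ b ∷ c ∷ [])
cover w≤3 {v₀} vs v₀∈ with enumerate w≤3 v₀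
... | a , b , c , all = retract a , retract b , retract c ,
  retract∈ a ∷ retract∈ b ∷ retract∈ c ∷ [] ,
  λ {v} v∈ → subst (_∈ _) (retract-id v v∈) (∈-map⁺ retract (all v))
  where
  retract : Fin _ → Fin _
  retract v with _∈?_ Fin._≟_ v vs
  ... | yes _ = v
  ... | no  _ = v₀
  retract∈ : ∀ v → retract v ∈ vs
  retract∈ v with _∈?_ Fin._≟_ v vs
  ... | yes v∈ = v∈
  ... | no  _  = v₀∈
  retract-id : ∀ v → v ∈ vs → retract v ≡ v
  retract-id v v∈ with _∈?_ Fin._≟_ v vs
  ... | yes _  = refl
  ... | no  v∉ = contradiction v∈ v∉

-- Acceptance probabilities under averaging.

average-big : ∀ {ε p q} → ε ≤ ½ * (p + q) → ε ≤ p ⊎ ε ≤ q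
average-big {ε} {p} {q} ε≤ with ≤-total p q
... | inj₁ p≤q = inj₂ (≤-trans ε≤ (≤-trans (*-monoˡ-≤-nonNeg ½ (+-monoˡ-≤ q p≤q))
                   (≤-reflexive (solve 1 (λ q → con ½ :* (q :+ q) := q) refl q))))
... | inj₂ q≤p = inj₁ (≤-trans ε≤ (≤-trans (*-monoˡ-≤-nonNeg ½ (+-monoʳ-≤ p q≤p))
                   (≤-reflexive (solve 1 (λ p → con ½ :* (p :+ p) := p) refl p))))

-- Both children carry the same error `e`, so it passes upwards unchanged while the main parts `a`
-- and `b` are averaged.
average : ∀ {n a b m e} {x : Fin n} c d → acceptance (c d) ≤ a + e → acceptance (c (not d)) ≤ b + e →
  ½ * (a + b) ≤ m → acceptance (node x c) ≤ m + e
average {a = a} {b} {m} {e} {x} c d a≤ b≤ ≤m = begin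
  acceptance (node x c)                                ≡⟨ symmetric d ⟩
  ½ * (acceptance (c d) + acceptance (c (not d)))     ≤⟨ *-monoˡ-≤-nonNeg ½ (+-mono-≤ a≤ b≤) ⟩
  ½ * ((a + e) + (b + e))                              ≡⟨ solve 3 (λ a b e → con ½ :* ((a :+ e) :+ (b :+ e)) := con ½ :* (a :+ b) :+ e) refl a b e ⟩
  ½ * (a + b) + e                                      ≤⟨ +-monoˡ-≤ e ≤m ⟩
  m + e                                                ∎
  where
  open ≤-Reasoning
  symmetric : ∀ d → acceptance (node x c) ≡ ½ * (acceptance (c d) + acceptance (c (not d)))
  symmetric true  = refl
  symmetric false = cong (½ *_) (+-comm (acceptance (c true)) (acceptance (c false)))

keep≤1 : ∀ r → keep r ≤ 1ℚ
keep≤1 r = ≤-from-difference (0≤* (toWitness {a? = 0ℚ ≤? (+ 3 / 8)} _) (pow2inv-nonneg r))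
  (solve 1 (λ p → con 1ℚ :- (con 1ℚ :- con (+ 3 / 8) :* p) := con (+ 3 / 8) :* p) refl (pow2inv r))

0≤keep : ∀ r → 0ℚ ≤ keep r
0≤keep r = ≤-from-difference
  (0≤+ (0≤* (toWitness {a? = 0ℚ ≤? (+ 3 / 8)} _) (≤⇒0≤- (pow2inv≤1 r))) (toWitness {a? = 0ℚ ≤? (+ 5 / 8)} _))
  (solve 1 (λ p → (con 1ℚ :- con (+ 3 / 8) :* p) :- con 0ℚ := con (+ 3 / 8) :* (con 1ℚ :- p) :+ con (+ 5 / 8)) refl (pow2inv r))

module _ {m : ℚ} (0≤m : 0ℚ ≤ m) where

  keep-≤ : ∀ r → keep r * m ≤ m
  keep-≤ r = subst (keep r * m ≤_) (*-identityˡ m) (*-mono-≤ (0≤keep r) 0≤m (keep≤1 r) ≤-refl)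

  half-same : ½ * (m + m) ≤ m
  half-same = ≤-reflexive (solve 1 (λ m → con ½ :* (m :+ m) := m) refl m)

  -- Averaging with `m` halves the deficit 1 - `keep r`, which is why `keep` approaches 1 like 2^-r.
  half-keep : ∀ r → ½ * (m + keep r * m) ≤ keep (suc r) * m
  half-keep r = ≤-reflexive (solve 2
    (λ m p → con ½ :* (m :+ (con 1ℚ :- con (+ 3 / 8) :* p) :* m) := (con 1ℚ :- con (+ 3 / 8) :* (con ½ :* p)) :* m)
    refl m (pow2inv r))

  half-zero : ½ * (m + 0ℚ) ≤ keep 0 * m
  half-zero = ≤-from-difference (0≤* (toWitness {a? = 0ℚ ≤? (+ 1 / 8)} _) 0≤m)
    (solve 1 (λ m → con (keep 0) :* m :- con ½ :* (m :+ con 0ℚ) := con (+ 1 / 8) :* m) refl m)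

  -- 5/8 · 29/32 ≥ 1/2, where 5/8 = keep 0 and 29/32 = keep 2.
  half-zero-shrunk : ∀ r → ½ * (m + 0ℚ) ≤ keep 0 * (keep (suc (suc r)) * m)
  half-zero-shrunk r = ≤-from-difference
    (0≤* (0≤+ (0≤* (toWitness {a? = 0ℚ ≤? (+ 15 / 256)} _) (≤⇒0≤- (pow2inv≤1 r))) (toWitness {a? = 0ℚ ≤? (+ 17 / 256)} _)) 0≤m)
    (solve 2 (λ m p → con (keep 0) :* ((con 1ℚ :- con (+ 3 / 8) :* (con ½ :* (con ½ :* p))) :* m) :- con ½ :* (m :+ con 0ℚ)
      := (con (+ 15 / 256) :* (con 1ℚ :- p) :+ con (+ 17 / 256)) :* m) refl m (pow2inv r))

  keep-suc-≥ : ∀ r → keep r * m ≤ keep (suc r) * m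
  keep-suc-≥ r = ≤-from-difference
    (0≤* (0≤* (toWitness {a? = 0ℚ ≤? (+ 3 / 16)} _) (pow2inv-nonneg r)) 0≤m)
    (solve 2 (λ m p → (con 1ℚ :- con (+ 3 / 8) :* (con ½ :* p)) :* m :- (con 1ℚ :- con (+ 3 / 8) :* p) :* m
      := (con (+ 3 / 16) :* p) :* m) refl m (pow2inv r))

  module _ (m≤1 : m ≤ 1ℚ) where

    keep-0-cap : keep 0 * m ≤ + 13 / 16
    keep-0-cap = ≤-trans (*-monoˡ-≤-nonNeg (keep 0) m≤1) (toWitness {a? = keep 0 * 1ℚ ≤? (+ 13 / 16)} _)

    -- `keep 1` equals 13/16, the origin of that constant: it is the largest bound met when a level
    -- with nothing pending loses its good tree.
    keep-1-cap : keep 1 * m ≤ + 13 / 16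
    keep-1-cap = ≤-trans (*-monoˡ-≤-nonNeg (keep 1) m≤1) (toWitness {a? = keep 1 * 1ℚ ≤? (+ 13 / 16)} _)

    keep-≤1 : ∀ r → keep r * m ≤ 1ℚ
    keep-≤1 r = ≤-trans (keep-≤ r) m≤1

weight-nonneg : ∀ {n} (Rs : List (Literals n)) → 0ℚ ≤ weight Rs
weight-nonneg []       = toWitness {a? = 0ℚ ≤? 1ℚ} _
weight-nonneg (R ∷ Rs) = 0≤* (≤⇒0≤- (pow2inv≤1 (length R))) (weight-nonneg Rs)

weight-tail : ∀ {n} (R : Literals n) Rs → weight (R ∷ Rs) ≤ weight Rs
weight-tail R Rs = ≤-from-difference (0≤* (pow2inv-nonneg (length R)) (weight-nonneg Rs))
  (solve 2 (λ p w → w :- (con 1ℚ :- p) :* w := p :* w) refl (pow2inv (length R)) (weight Rs))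

-- Fresh variables and the two children of a node.

module _ {n : ℕ} where

  _Uses_ : Tree n → Literals n → Set
  t Uses ls = All (λ l → proj₁ l Occurs t) ls

  uses-child : ∀ {x c ls} d → c d Uses ls → node x c Uses ls
  uses-child d = All.map (there d)

  -- Read-onceness enters the bookkeeping here: a variable queried above `t` is new to every list
  -- whose variables all occur in `t`. The `uses` fields of the invariant supply the premise.
  fresh : ∀ {x t ls} → ¬ x Occurs t → t Uses ls → All (x ≢_) (map proj₁ ls)
  fresh x∉t uses = All.map⁺ (All.map (λ occ x≡ → Occurs⇒≢ x∉t occ (sym x≡)) uses)

  fresh-++ : ∀ {x} (R : Literals n) {S} → All (x ≢_) (map proj₁ R) → All (x ≢_) (map proj₁ S) → All (x ≢_) (map proj₁ (R ++ S))
  fresh-++ {x} R {S} p q = subst (All (x ≢_)) (sym (map-++ proj₁ R S)) (All.++⁺ p q)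

  data Pair (A B : Tree n → Set) : Tree n → Set where
    pair : ∀ {x c} d → (∀ e → ¬ x Occurs c e) → A (c d) → B (c (not d)) → Pair A B (node x c)

  directions : ∀ {P : Bool → Set} d → P d → P (not d) → ∀ e → P e
  directions true  p q true  = p
  directions true  p q false = q
  directions false p q true  = q
  directions false p q false = p

  follow-any : ∀ {a k x c} d → Hits {n} a k (c d) → Hits a k (c (not d)) → Hits a k (node x c)
  follow-any {a} {k} {x} {c} d p q = follow (directions {P = λ e → Hits a k (c e)} d p q (a x))

-- The invariant of a level.

error : ℕ → ℕ → ℚ
error L zero    = 0ℚ
error L (suc D) = pow2inv L + error L D

error-suc : ∀ L D → error L D ≤ error L (suc D)
error-suc L D = subst (_≤ error L (suc D)) (+-identityˡ (error L D)) (+-monoˡ-≤ (error L D) (pow2inv-nonneg L))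

module Descent {n : ℕ} (L : ℕ) (ε ε′ : ℚ) where

  -- Up to the error `e`, which charges 2^-`L` for each of the `drops` chains given up, `m` bounds
  -- every acceptance probability on the level. Through `m¹¹≤` a large `m` certifies a large product
  -- over the clauses, the quantity that richness asks about.
  record Frame : Set where
    field
      clauses  : List (Literals n)
      m        : ℚ
      drops    : ℕ
      distinct : Distinct (concat clauses)
      nonempty : All NonEmpty clauses
      0≤m      : 0ℚ ≤ m
      m≤1      : m ≤ 1ℚ
      m¹¹≤     : powℚ m 11 ≤ weight clauses

    base : List (Literals n)
    base = drop 1 clauses

    e : ℚ
    e = error L drops

    base-distinct : Distinct (concat base)
    base-distinct with clauses | distinct
    ... | []     | u = u
    ... | R ∷ Rs | u = distinct-++⁻ʳ R u

    base-uses : ∀ {t} → t Uses concat clauses → t Uses concat base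
    base-uses u with clauses
    ... | []     = u
    ... | R ∷ Rs = All.++⁻ʳ R u

    base-weight : weight clauses ≤ weight base
    base-weight with clauses
    ... | []     = ≤-refl
    ... | R ∷ Rs = weight-tail R Rs

  record Good (F : Frame) (t : Tree n) : Set where
    open Frame F
    field
      hits₀ : ∀ {a} → All (Breaks a) clauses → Hits a 0 t
      hits₁ : ∀ {a} → All (Breaks a) base → Hits a 1 t
      uses  : t Uses concat clauses
      bound : acceptance t ≤ m + e

  record Bad (F : Frame) (t : Tree n) : Set where
    constructor mkBad
    field
      bound : acceptance t ≤ 0ℚ + Frame.e F

  -- A chain started when a clause is committed hangs above trees that need not contain the
  -- variables of that clause, so `distinctT` and `uses-base` refer to `base` only. A nonempty `R`
  -- shows that the chain has passed a good sibling, which provides the variables of all clauses and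
  -- the deviation for `skip`. In `boundT` the first literal does not count, since a chain restarted
  -- beside a good tree may accept with probability near 1.
  record Chain (F : Frame) (R T : Literals n) (t : Tree n) : Set where
    open Frame F
    field
      avoid     : ∀ {a} → All (Breaks a) clauses → Breaks a R → Hits a 0 t
      skip      : NonEmpty R → ∀ {a} → All (Breaks a) clauses → Hits a 1 t
      force     : ∀ {a} → All (Breaks a) base → Agrees a T → Hits a 1 t
      distinctR : Distinct (R ++ concat clauses)
      distinctT : Distinct (T ++ concat base)
      usesR     : t Uses R
      usesT     : t Uses T
      uses-base : t Uses concat base
      uses      : NonEmpty R → t Uses concat clauses
      boundR    : acceptance t ≤ keep (length R) * m + e
      boundT    : acceptance t ≤ pow2inv (ℕ.pred (length T)) + e

  -- The inequality in `chain` is a budget of levels, `h` of which have been processed: each literal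
  -- of the current term took a level of its own, and each chain given up took `L` of them.
  data Second (F : Frame) (h : ℕ) (t : Tree n) : Set where
    good  : Good F t → Second F h t
    chain : ∀ {R T} → Chain F R T t → 1 ℕ.≤ length T → length T ℕ.≤ L →
            Frame.drops F ℕ.* L ℕ.+ length T ℕ.≤ h → Second F h t
    bad   : Bad F t → Second F h t

  record State (h : ℕ) (ts : List (Tree n)) : Set where
    constructor state
    field
      F       : Frame
      {g y z} : Tree n
      g-good  : Good F g
      y-kind  : Second F h y
      z-bad   : Bad F z
      drops≤  : Frame.drops F ℕ.* L ℕ.≤ h
      roles   : ts ↭ g ∷ y ∷ z ∷ []

  -- Once every tree of a level is hit, following `a` from above ends in one of them, so `Done`
  -- passes unchanged to the source. Of the two deviations one leads into a good tree or a chain,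
  -- the other is left for the subtree there.
  record Done (ts : List (Tree n)) : Set where
    field
      clauses  : List (Literals n)
      term     : Literals n
      distinct : Distinct (term ++ concat clauses)
      nonempty : All NonEmpty clauses
      term≤    : length term ℕ.≤ L
      weight≥  : powℚ ε′ 11 ≤ weight clauses
      hits     : ∀ {a} → All (Breaks a) clauses → Agrees a term → ∀ {t} → t ∈ ts → Hits a 2 t

  Start : Frame → Tree n → Set
  Start F t = ∃ λ l → Chain F [] (l ∷ []) t

  data Role (F : Frame) (t : Tree n) : Set where
    good  : Good F t → Role F t
    start : Start F t → Role F t
    bad   : Bad F t → Role F t

  -- By averaging, a tree of acceptance `ε` on one level yields another on the level below. This
  -- excludes levels without a good tree.
  Big : List (Tree n) → Set
  Big ts = ∃ λ t → t ∈ ts × ε ≤ acceptance t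

  big-↭ : ∀ {ts us} → ts ↭ us → Big ts → Big us
  big-↭ p (t , t∈ , ε≤) = t , ∈-resp-↭ p t∈ , ε≤

  data Two (F : Frame) (t : Tree n) : Set where
    gg : Pair (Good F) (Good F) t → Two F t
    gb : Pair (Good F) (Bad F) t → Two F t
    bb : Pair (Bad F) (Bad F) t → Two F t

  data Mixed (F : Frame) (R T : Literals n) (t : Tree n) : Set where
    gy : Pair (Good F) (Chain F R T) t → Mixed F R T t
    yy : Pair (Chain F R T) (Chain F R T) t → Mixed F R T t
    yb : Pair (Chain F R T) (Bad F) t → Mixed F R T t

  bad-cap : ∀ F {t} → Bad F t → acceptance t ≤ + 13 / 16 + Frame.e F
  bad-cap F b = ≤-trans (Bad.bound b) (+-monoˡ-≤ (Frame.e F) (toWitness {a? = 0ℚ ≤? (+ 13 / 16)} _))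

  bb-bad : ∀ F {t} → Pair (Bad F) (Bad F) t → Bad F t
  bb-bad F (pair {x} {c} d _ p q) =
    mkBad (average {a = 0ℚ} {0ℚ} {0ℚ} {Frame.e F} {x} c d (Bad.bound p) (Bad.bound q) ≤-refl)

  module _ (F : Frame) where
    open Frame F
    open Good

    gg-good : ∀ {t} → Pair (Good F) (Good F) t → Good F t
    gg-good (pair {x} {c} d _ p q) = record
      { hits₀ = λ br → follow-any d (hits₀ p br) (hits₀ q br)
      ; hits₁ = λ br → follow-any d (hits₁ p br) (hits₁ q br)
      ; uses  = uses-child d (uses p)
      ; bound = average {a = m} {m} {m} {e} {x} c d (bound p) (bound q) (half-same 0≤m)
      }

    -- b stands for the value bound of the child before a possible shrinking of m.
    start-node : ∀ {x c b} d → ¬ x Occurs c d →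
      (∀ {a} → All (Breaks a) base → Hits a 1 (c d)) → c d Uses concat base →
      acceptance (c d) ≤ b + e → ½ * (b + 0ℚ) ≤ keep 0 * m → Bad F (c (not d)) → Start F (node x c)
    start-node {x} {c} {b} d x∉ hit use b≤ half≤ other = (x , d) , record
      { avoid     = λ _ ()
      ; skip      = λ ()
      ; force     = λ { br (ax≡d ∷ []) → follow (subst (λ e → Hits _ 1 (c e)) (sym ax≡d) (hit br)) }
      ; distinctR = distinct
      ; distinctT = fresh x∉ use ∷ base-distinct
      ; usesR     = []
      ; usesT     = here ∷ []
      ; uses-base = uses-child d use
      ; uses      = λ ()
      ; boundR    = bound₀
      ; boundT    = ≤-trans bound₀ (+-monoˡ-≤ e (keep-≤1 0≤m m≤1 0))
      }
      where
      bound₀ : acceptance (node x c) ≤ keep 0 * m + e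
      bound₀ = average {a = b} {0ℚ} {keep 0 * m} {e} {x} c d b≤ (Bad.bound other) half≤

    gb-start : ∀ {t} → Pair (Good F) (Bad F) t → Start F t
    gb-start (pair d x∉ p q) =
      start-node {b = m} d (x∉ d) (hits₁ p) (base-uses (uses p)) (bound p) (half-zero 0≤m) q

    two-role : ∀ {t} → Two F t → Role F t
    two-role (gg p) = good (gg-good p)
    two-role (gb p) = start (gb-start p)
    two-role (bb p) = bad (bb-bad F p)

    role-cap : ∀ {t} → Start F t → acceptance t ≤ + 13 / 16 + e
    role-cap (_ , ch) = ≤-trans (Chain.boundR ch) (+-monoˡ-≤ e (keep-0-cap 0≤m m≤1))

    capped⊥ : + 13 / 16 + e < ε → ∀ {ts} → All (λ t → acceptance t ≤ + 13 / 16 + e) ts → ¬ Big ts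
    capped⊥ gap caps (t , t∈ , ε≤) = <-irrefl refl (<-≤-trans gap (≤-trans ε≤ (All.lookup caps t∈)))

    -- At least one of the two roles is good: otherwise all three trees stay within 13/16 + `e`,
    -- which is less than `ε`, against `Big`.
    assemble : ∀ {h ts w₁ w₂ z} → 1 ℕ.≤ L → + 13 / 16 + e < ε → drops ℕ.* L ℕ.≤ h →
      Role F w₁ → Role F w₂ → Bad F z → ts ↭ w₁ ∷ w₂ ∷ z ∷ [] → Big ts → State (suc h) ts
    assemble 1≤L gap D≤ r₁ r₂ b perm big = go r₁ r₂
      where
      D≤′ = ℕ.m≤n⇒m≤1+n D≤
      starting : ∀ {t} → Start F t → Second F _ t
      starting (_ , ch) = chain ch ℕ.≤-refl 1≤L (ℕ.≤-trans (ℕ.≤-reflexive (ℕ.+-comm _ 1)) (s≤s D≤))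
      perm′ = ↭-trans perm (swap _ _ ↭-refl)
      go : Role F _ → Role F _ → State _ _
      go (good p)  (good q)  = state F p (good q) b D≤′ perm
      go (good p)  (start q) = state F p (starting q) b D≤′ perm
      go (good p)  (bad q)   = state F p (bad q) b D≤′ perm
      go (start p) (good q)  = state F q (starting p) b D≤′ perm′
      go (bad p)   (good q)  = state F q (bad p) b D≤′ perm′
      go (start p) (start q) = ⊥-elim (capped⊥ gap (role-cap p ∷ role-cap q ∷ bad-cap F b ∷ []) (big-↭ perm big))
      go (start p) (bad q)   = ⊥-elim (capped⊥ gap (role-cap p ∷ bad-cap F q ∷ bad-cap F b ∷ []) (big-↭ perm big))
      go (bad p)   (start q) = ⊥-elim (capped⊥ gap (bad-cap F p ∷ role-cap q ∷ bad-cap F b ∷ []) (big-↭ perm big))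
      go (bad p)   (bad q)   = ⊥-elim (capped⊥ gap (bad-cap F p ∷ bad-cap F q ∷ bad-cap F b ∷ []) (big-↭ perm big))

  -- Classification of the nodes one level up.

  data Parent (ts : List (Tree n)) : Tree n → Set where
    parent : ∀ {x c} → (∀ d → ¬ x Occurs c d) → (∀ d → c d ∈ ts) → Parent ts (node x c)

  module _ (F : Frame) where
    open Frame F

    data Child₂ (t : Tree n) : Set where
      G : Good F t → Child₂ t
      B : Bad F t → Child₂ t

    two-node : ∀ {x c} → (∀ d → ¬ x Occurs c d) → (∀ d → Child₂ (c d)) → Two F (node x c)
    two-node x∉ ch with ch true | ch false
    ... | G p | G q = gg (pair true x∉ p q)
    ... | G p | B q = gb (pair true x∉ p q)
    ... | B p | G q = gb (pair false x∉ q p)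
    ... | B p | B q = bb (pair true x∉ p q)

    data Child₃ (R T : Literals n) (t : Tree n) : Set where
      G : Good F t → Child₃ R T t
      Y : Chain F R T t → Child₃ R T t
      B : Bad F t → Child₃ R T t

    three-node : ∀ {x c R T} → (∀ d → ¬ x Occurs c d) → (∀ d → Child₃ R T (c d)) →
      Two F (node x c) ⊎ Mixed F R T (node x c)
    three-node x∉ ch with ch true | ch false
    ... | G p | G q = inj₁ (gg (pair true x∉ p q))
    ... | G p | Y q = inj₂ (gy (pair true x∉ p q))
    ... | G p | B q = inj₁ (gb (pair true x∉ p q))
    ... | Y p | G q = inj₂ (gy (pair false x∉ q p))
    ... | Y p | Y q = inj₂ (yy (pair true x∉ p q))
    ... | Y p | B q = inj₂ (yb (pair true x∉ p q))
    ... | B p | G q = inj₁ (gb (pair false x∉ q p))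
    ... | B p | Y q = inj₂ (yb (pair false x∉ q p))
    ... | B p | B q = inj₁ (bb (pair true x∉ p q))

    chain-cap : ∀ {R T t} → Chain F R T t → acceptance t ≤ m + e
    chain-cap {R} ch = ≤-trans (Chain.boundR ch) (+-monoˡ-≤ e (keep-≤ 0≤m (length R)))

    bad-≤ : ∀ {t} → Bad F t → acceptance t ≤ m + e
    bad-≤ b = ≤-trans (Bad.bound b) (+-monoˡ-≤ e 0≤m)

    node-cap : ∀ {x} {c : Bool → Tree n} → (∀ d → acceptance (c d) ≤ m + e) → acceptance (node x c) ≤ m + e
    node-cap {x} {c} cap = average {a = m} {m} {m} {e} {x} c true (cap true) (cap false) (half-same 0≤m)

    -- The gap between `ε′` and `ε` absorbs the error. The result is what turns `m¹¹≤` into the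
    -- hypothesis of richness when `done` is reached.
    m-large : ε′ + e ≤ ε → ∀ {ts} → All (λ t → acceptance t ≤ m + e) ts → Big ts → ε′ ≤ m
    m-large close caps (t , t∈ , ε≤) = ≤-from-difference
      (≤⇒0≤- (≤-trans close (≤-trans ε≤ (All.lookup caps t∈))))
      (solve 3 (λ m ε′ e → m :- ε′ := (m :+ e) :- (ε′ :+ e)) refl m ε′ e)

    done : ∀ {ts} T → ε′ ≤ m → Distinct (T ++ concat base) → length T ℕ.≤ L →
      All (λ t → ∀ {a} → All (Breaks a) base → Agrees a T → Hits a 2 t) ts → Done ts
    done T ε′≤m u T≤ hits = record
      { clauses  = base
      ; term     = T
      ; distinct = u
      ; nonempty = All.drop⁺ 1 nonempty
      ; term≤    = T≤
      ; weight≥  = ≤-trans (powℚ-11-mono 0≤m ε′≤m) (≤-trans m¹¹≤ base-weight)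
      ; hits     = λ br ag t∈ → All.lookup hits t∈ br ag
      }

  -- Committing the pending clause.

  commit-frame : ∀ (F : Frame) l {R} → Distinct ((l ∷ R) ++ concat (Frame.clauses F)) → Frame
  commit-frame F l {R} u = record
    { clauses  = (l ∷ R) ∷ clauses
    -- For a clause of length `r`, a good child and a chain average to `keep (suc r) * m`; the extra
    -- unit is the query above the chain.
    ; m        = keep (suc (suc (length R))) * m
    ; drops    = drops
    ; distinct = u
    ; nonempty = s≤s z≤n ∷ nonempty
    ; 0≤m      = 0≤* (0≤keep (suc (suc (length R)))) 0≤m
    ; m≤1      = keep-≤1 0≤m m≤1 (suc (suc (length R)))
    ; m¹¹≤     = subst (_≤ weight ((l ∷ R) ∷ clauses)) (sym (powℚ-distrib-* (keep (suc (suc (length R)))) m 11))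
                   (*-mono-≤ (powℚ-nonneg 11 (0≤keep (suc (suc (length R))))) (weight-nonneg clauses) (keep-11 (length R)) m¹¹≤)
    }
    where open Frame F

  -- Every shape but two good children. After a commit each of them fits under the shrunk `m`.
  data Lossy (F : Frame) (R T : Literals n) (t : Tree n) : Set where
    gb    : Pair (Good F) (Bad F) t → Lossy F R T t
    bb    : Pair (Bad F) (Bad F) t → Lossy F R T t
    mixed : Mixed F R T t → Lossy F R T t

  module _ {F : Frame} {l : Fin n × Bool} {R T : Literals n}
           (u : Distinct ((l ∷ R) ++ concat (Frame.clauses F))) where
    open Frame F
    open Good
    open Chain

    private
      F′ = commit-frame F l u
      r : ℕ
      r = suc (length R)
      1≤r : NonEmpty (l ∷ R)
      1≤r = s≤s z≤n

    -- The base of the new frame is the full list of old clauses. One-deviation fields therefore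
    -- come from `hits₀`, weakened, and from `skip`, while the new `hits₀` hands the broken clause
    -- to `avoid`. The old term is dropped.
    commit-role : ∀ {t} → Lossy F (l ∷ R) T t → Role F′ t
    commit-role (gb (pair d x∉ p q)) = start (start-node F′ {b = m} d (x∉ d)
      (λ br → Hits-weaken (hits₀ p br)) (uses p) (bound p)
      (half-zero-shrunk 0≤m (length R)) (mkBad (Bad.bound q)))
    commit-role (bb p) = bad (mkBad (Bad.bound (bb-bad F p)))
    commit-role (mixed (gy (pair {x} {c} d x∉ p q))) = good record
      { hits₀ = λ { (br ∷ brs) → follow-any d (hits₀ p brs) (avoid q brs br) }
      ; hits₁ = λ brs → follow-any d (Hits-weaken (hits₀ p brs)) (skip q 1≤r brs)
      ; uses  = All.++⁺ (uses-child (not d) (usesR q)) (uses-child d (uses p))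
      ; bound = average {a = m} {keep r * m} {keep (suc r) * m} {e} {x} c d (bound p) (boundR q) (half-keep 0≤m r)
      }
    commit-role (mixed (yy (pair {x} {c} d x∉ p q))) = good record
      { hits₀ = λ { (br ∷ brs) → follow-any d (avoid p brs br) (avoid q brs br) }
      ; hits₁ = λ brs → follow-any d (skip p 1≤r brs) (skip q 1≤r brs)
      ; uses  = uses-child d (All.++⁺ (usesR p) (Chain.uses p 1≤r))
      ; bound = average {a = keep r * m} {keep r * m} {keep (suc r) * m} {e} {x} c d (boundR p) (boundR q)
                  (≤-trans (half-same (0≤* (0≤keep r) 0≤m)) (keep-suc-≥ 0≤m r))
      }
    commit-role (mixed (yb (pair d x∉ p q))) = start (start-node F′ {b = m} d (x∉ d)
      (λ br → skip p 1≤r br) (Chain.uses p 1≤r) (chain-cap F p)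
      (half-zero-shrunk 0≤m (length R)) (mkBad (Bad.bound q)))

  -- With nothing pending there is no clause to commit. But then the chain accepts with at most 5/8
  -- of `m` up to error, which keeps every lossy tree within the cap that `Big` contradicts.
  lossy-cap : ∀ F {T t} → Lossy F [] T t → acceptance t ≤ + 13 / 16 + Frame.e F
  lossy-cap F (gb p) = role-cap F (gb-start F p)
  lossy-cap F (bb p) = bad-cap F (bb-bad F p)
  lossy-cap F (mixed (gy (pair {x} {c} d _ p q))) = average {a = m} {keep 0 * m} {_} {e} {x} c d (Good.bound p) (Chain.boundR q)
    (≤-trans (half-keep 0≤m 0) (keep-1-cap 0≤m m≤1))
    where open Frame F
  lossy-cap F (mixed (yy (pair {x} {c} d _ p q))) = average {a = keep 0 * m} {keep 0 * m} {_} {e} {x} c d (Chain.boundR p) (Chain.boundR q)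
    (≤-trans (half-same (0≤* (0≤keep 0) 0≤m)) (keep-0-cap 0≤m m≤1))
    where open Frame F
  lossy-cap F (mixed (yb (pair {x} {c} d _ p q))) = average {a = m} {0ℚ} {_} {e} {x} c d (chain-cap F p) (Bad.bound q)
    (≤-trans (half-zero 0≤m) (keep-0-cap 0≤m m≤1))
    where open Frame F

  -- Extending and abandoning chains.

  module _ (F : Frame) where
    open Frame F
    open Good
    open Chain

    -- The edge to the good child escapes, so the pending clause grows by the opposite literal. The
    -- term starts afresh with the one literal that leads to the good tree.
    chain-gy : ∀ {R T t} → Pair (Good F) (Chain F R T) t → ∃ λ l → ∃ λ l′ → Chain F (l ∷ R) (l′ ∷ []) t
    chain-gy {R} {T} (pair {x} {c} d x∉ p q) = (x , not d) , (x , d) , record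
      { avoid     = λ { brs (here ax≡) → follow (subst (λ b → Hits _ 0 (c b)) (sym (trans ax≡ (not-involutive d))) (hits₀ p brs))
                      ; brs (there br) → follow-any d (hits₀ p brs) (avoid q brs br) }
      ; skip      = λ _ brs → deviate d (hits₀ p brs)
      ; force     = λ { brs (ax≡ ∷ []) → follow (subst (λ b → Hits _ 1 (c b)) (sym ax≡) (hits₁ p brs)) }
      ; distinctR = fresh-++ R (fresh (x∉ (not d)) (usesR q)) (fresh (x∉ d) (uses p)) ∷ distinctR q
      ; distinctT = fresh (x∉ d) (base-uses (uses p)) ∷ base-distinct
      ; usesR     = here ∷ uses-child (not d) (usesR q)
      ; usesT     = here ∷ []
      ; uses-base = uses-child d (base-uses (uses p))
      ; uses      = λ _ → uses-child d (uses p)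
      ; boundR    = bound′
      ; boundT    = ≤-trans bound′ (+-monoˡ-≤ e (keep-≤1 0≤m m≤1 (suc (length R))))
      }
      where
      bound′ : acceptance (node x c) ≤ keep (suc (length R)) * m + e
      bound′ = average {a = m} {keep (length R) * m} {keep (suc (length R)) * m} {e} {x} c d
        (bound p) (boundR q) (half-keep 0≤m (length R))

    chain-yy : ∀ {R T t} → Pair (Chain F R T) (Chain F R T) t → Chain F R T t
    chain-yy {R} {T} (pair {x} {c} d x∉ p q) = record
      { avoid     = λ brs br → follow-any d (avoid p brs br) (avoid q brs br)
      ; skip      = λ ne brs → follow-any d (skip p ne brs) (skip q ne brs)
      ; force     = λ brs ag → follow-any d (force p brs ag) (force q brs ag)
      ; distinctR = distinctR p
      ; distinctT = distinctT p
      ; usesR     = uses-child d (usesR p)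
      ; usesT     = uses-child d (usesT p)
      ; uses-base = uses-child d (uses-base p)
      ; uses      = λ ne → uses-child d (Chain.uses p ne)
      ; boundR    = same (0≤* (0≤keep (length R)) 0≤m) (boundR p) (boundR q)
      ; boundT    = same (pow2inv-nonneg (ℕ.pred (length T))) (boundT p) (boundT q)
      }
      where
      same : ∀ {b} → 0ℚ ≤ b → acceptance (c d) ≤ b + e → acceptance (c (not d)) ≤ b + e → acceptance (node x c) ≤ b + e
      same {b} 0≤b p≤ q≤ = average {a = b} {b} {b} {e} {x} c d p≤ q≤ (half-same 0≤b)

    yb-bound : ∀ {R T t} → Pair (Chain F R T) (Bad F) t → 1 ℕ.≤ length T → acceptance t ≤ pow2inv (length T) + e
    yb-bound {T = T@(l ∷ T′)} (pair {x} {c} d x∉ p q) _ =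
      average {a = pow2inv (length T′)} {0ℚ} {pow2inv (length T)} {e} {x} c d (boundT p) (Bad.bound q)
        (≤-reflexive (cong (½ *_) (+-identityʳ (pow2inv (length T′)))))

    -- Past an edge into the bad tree no clause guarantees acceptance, so `R` is discarded for the
    -- empty clause, which no word breaks. The term grows instead, and the added literal halves
    -- `boundT`.
    chain-yb : ∀ {R T t} → Pair (Chain F R T) (Bad F) t → 1 ℕ.≤ length T → ∃ λ l → Chain F [] (l ∷ T) t
    chain-yb {R} {T} pr@(pair {x} {c} d x∉ p q) 1≤T = (x , d) , record
      { avoid     = λ _ ()
      ; skip      = λ ()
      ; force     = λ { brs (ax≡ ∷ ag) → follow (subst (λ b → Hits _ 1 (c b)) (sym ax≡) (force p brs ag)) }
      ; distinctR = distinct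
      ; distinctT = fresh-++ T (fresh (x∉ d) (usesT p)) (fresh (x∉ d) (uses-base p)) ∷ distinctT p
      ; usesR     = []
      ; usesT     = here ∷ uses-child d (usesT p)
      ; uses-base = uses-child d (uses-base p)
      ; uses      = λ ()
      ; boundR    = average {a = m} {0ℚ} {keep 0 * m} {e} {x} c d (chain-cap F p) (Bad.bound q) (half-zero 0≤m)
      ; boundT    = yb-bound pr 1≤T
      }

    -- The acceptance probability 2^-L of the abandoned chain is charged to the error.
    abandon-frame : Frame
    abandon-frame = record
      { clauses = clauses ; m = m ; drops = suc drops ; distinct = distinct
      ; nonempty = nonempty ; 0≤m = 0≤m ; m≤1 = m≤1 ; m¹¹≤ = m¹¹≤ }

    abandon-good : ∀ {t} → Good F t → Good abandon-frame t
    abandon-good p = record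
      { hits₀ = hits₀ p ; hits₁ = hits₁ p ; uses = uses p
      ; bound = ≤-trans (bound p) (+-monoʳ-≤ m (error-suc L drops)) }

    abandon-bad : ∀ {t} → Bad F t → Bad abandon-frame t
    abandon-bad p = mkBad (≤-trans (Bad.bound p) (+-monoʳ-≤ 0ℚ (error-suc L drops)))

    -- A good tree survives with `m` unchanged, so nothing is committed and only the chain moves on.
    continue : ∀ {R T h ts w₁ w₂ z} → 1 ℕ.≤ length T → length T ℕ.≤ L →
      drops ℕ.* L ℕ.+ length T ℕ.≤ h → 1 ℕ.≤ L → drops ℕ.* L ℕ.≤ h →
      Mixed F R T w₁ → Good F w₂ → Bad F z → ts ↭ w₂ ∷ w₁ ∷ z ∷ [] → State (suc h) ts
    continue {R} {T} {h} {w₁ = w₁} 1≤T T≤L D≤ 1≤L D≤h mx p b perm = go mx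
      where
      D≤′ = ℕ.m≤n⇒m≤1+n D≤h
      go : Mixed F R T w₁ → State (suc h) _
      go (gy pr) with chain-gy pr
      ... | _ , _ , ch = state F p (chain ch ℕ.≤-refl 1≤L (ℕ.≤-trans (ℕ.≤-reflexive (ℕ.+-comm _ 1)) (s≤s D≤h))) b D≤′ perm
      go (yy pr) = state F p (chain (chain-yy pr) 1≤T T≤L (ℕ.m≤n⇒m≤1+n D≤)) b D≤′ perm
      go (yb pr) with length T ℕ.<? L
      ... | yes T<L with chain-yb pr 1≤T
      ...   | _ , ch = state F p (chain ch (s≤s z≤n) T<L (ℕ.≤-trans (ℕ.≤-reflexive (ℕ.+-suc _ _)) (s≤s D≤))) b D≤′ perm
      go (yb pr) | no T≮L = state abandon-frame (abandon-good p) (bad (mkBad small)) (abandon-bad b) D≤″ perm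
        where
        T≡L = ℕ.≤-antisym T≤L (ℕ.≮⇒≥ T≮L)
        small : acceptance w₁ ≤ 0ℚ + (pow2inv L + e)
        small = subst (acceptance w₁ ≤_) (sym (+-identityˡ (pow2inv L + e)))
          (subst (λ k → acceptance w₁ ≤ pow2inv k + e) T≡L (yb-bound pr 1≤T))
        -- The abandoned term has exactly `L` literals, so its share of the level budget pays for
        -- one more drop.
        D≤″ : suc drops ℕ.* L ℕ.≤ suc h
        D≤″ = ℕ.m≤n⇒m≤1+n (ℕ.≤-trans (ℕ.≤-reflexive (trans (ℕ.+-comm L _) (cong (drops ℕ.* L ℕ.+_) (sym T≡L)))) D≤)

  -- The descent from the sinks to the source.

  pick : ∀ {P Q : Tree n → Set} {a b c} → All (λ t → P t ⊎ Q t) (a ∷ b ∷ c ∷ []) →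
    All P (a ∷ b ∷ c ∷ []) ⊎ ∃ λ w₁ → ∃ λ w₂ → ∃ λ z → (a ∷ b ∷ c ∷ [] ↭ w₁ ∷ w₂ ∷ z ∷ []) × Q z
  pick {a = a} {b} {c} (inj₂ q ∷ _ ∷ _ ∷ []) =
    inj₂ (b , c , a , ↭-trans (swap a b ↭-refl) (prep b (swap a c ↭-refl)) , q)
  pick {a = a} {b} {c} (inj₁ _ ∷ inj₂ q ∷ _ ∷ []) = inj₂ (a , c , b , prep a (swap b c ↭-refl) , q)
  pick {a = a} {b} {c} (inj₁ _ ∷ inj₁ _ ∷ inj₂ q ∷ []) = inj₂ (a , b , c , ↭-refl , q)
  pick (inj₁ p ∷ inj₁ q ∷ inj₁ r ∷ []) = inj₁ (p ∷ q ∷ r ∷ [])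

  Done-parents : ∀ {ts us} → Done ts → All (Parent ts) us → Done us
  Done-parents dn parents = record
    { clauses = clauses ; term = term ; distinct = distinct ; nonempty = nonempty ; term≤ = term≤ ; weight≥ = weight≥
    ; hits = λ {a} br ag t∈ → up br ag (All.lookup parents t∈) }
    where
    open Done dn
    up : ∀ {a} → All (Breaks a) clauses → Agrees a term → ∀ {t} → Parent _ t → Hits a 2 t
    up br ag (parent x∉ c∈) = follow (hits br ag (c∈ _))

  empty-frame : Frame
  empty-frame = record
    { clauses = [] ; m = 1ℚ ; drops = 0 ; distinct = [] ; nonempty = []
    ; 0≤m = toWitness {a? = 0ℚ ≤? 1ℚ} _ ; m≤1 = ≤-refl ; m¹¹≤ = ≤-refl }

  module _ (1≤L : 1 ℕ.≤ L)
           (slack : ∀ D → D ℕ.* L ℕ.≤ suc n → (+ 13 / 16 + error L D < ε) × (ε′ + error L D ≤ ε)) where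

    two-class-step : ∀ F {h a b c} → Frame.drops F ℕ.* L ℕ.≤ h → h ℕ.≤ suc n →
      (∀ {t} → t ∈ a ∷ b ∷ c ∷ [] → Two F t) → ε′ ≤ Frame.m F →
      Big (a ∷ b ∷ c ∷ []) → Done (a ∷ b ∷ c ∷ []) ⊎ State (suc h) (a ∷ b ∷ c ∷ [])
    two-class-step F {a = a} {b} {c} D≤ h≤ two ε′≤m big with pick (All.tabulate (λ t∈ → one-flip (two t∈)))
      where
      one-flip : ∀ {t} → Two F t → (∀ {a} → All (Breaks a) (Frame.base F) → Agrees a [] → Hits a 2 t) ⊎ Pair (Bad F) (Bad F) t
      one-flip (gg (pair d _ p _)) = inj₁ λ brs _ → deviate d (Good.hits₁ p brs)
      one-flip (gb (pair d _ p _)) = inj₁ λ brs _ → deviate d (Good.hits₁ p brs)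
      one-flip (bb p)              = inj₂ p
    ... | inj₁ hits = inj₁ (done F [] ε′≤m (Frame.base-distinct F) z≤n hits)
    ... | inj₂ (w₁ , w₂ , z , perm , b) = inj₂ (assemble F 1≤L (proj₁ (slack (Frame.drops F) (ℕ.≤-trans D≤ h≤))) D≤
          (role (here refl)) (role (there (here refl))) (bb-bad F b) perm big)
      where
      role : ∀ {t} → t ∈ w₁ ∷ w₂ ∷ z ∷ [] → Role F t
      role t∈ = two-role F (two (∈-resp-↭ (↭-sym perm) t∈))

    commit-step : ∀ F {R T y h ts w₁ w₂ z} → Chain F R T y → Frame.drops F ℕ.* L ℕ.≤ h → h ℕ.≤ suc n →
      Lossy F R T w₁ → Lossy F R T w₂ → Bad F z → ts ↭ w₁ ∷ w₂ ∷ z ∷ [] → Big ts → State (suc h) ts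
    commit-step F {[]} ch D≤ h≤ p q b perm big = ⊥-elim
      (capped⊥ F (proj₁ (slack (Frame.drops F) (ℕ.≤-trans D≤ h≤))) (lossy-cap F p ∷ lossy-cap F q ∷ bad-cap F b ∷ []) (big-↭ perm big))
    commit-step F {l ∷ R} ch D≤ h≤ p q b perm big =
      assemble (commit-frame F l u) 1≤L (proj₁ (slack (Frame.drops F) (ℕ.≤-trans D≤ h≤))) D≤
        (commit-role u p) (commit-role u q) (mkBad (Bad.bound b)) perm big
      where u = Chain.distinctR ch

    chain-step : ∀ F {R T y h a b c} → Chain F R T y → 1 ℕ.≤ length T → length T ℕ.≤ L →
      Frame.drops F ℕ.* L ℕ.+ length T ℕ.≤ h → h ℕ.≤ suc n →
      (∀ {t} → t ∈ a ∷ b ∷ c ∷ [] → Two F t ⊎ Mixed F R T t) → ε′ ≤ Frame.m F →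
      Big (a ∷ b ∷ c ∷ []) → Done (a ∷ b ∷ c ∷ []) ⊎ State (suc h) (a ∷ b ∷ c ∷ [])
    chain-step F {R} {T} {h = h} {a} {b} {c} ch 1≤T T≤L DT≤ h≤ shape ε′≤m big
      with pick (All.tabulate (λ t∈ → one-flip (shape t∈)))
      where
      one-flip : ∀ {t} → Two F t ⊎ Mixed F R T t →
        (∀ {a} → All (Breaks a) (Frame.base F) → Agrees a T → Hits a 2 t) ⊎ Pair (Bad F) (Bad F) t
      one-flip (inj₁ (gg (pair d _ p _))) = inj₁ λ brs _ → deviate d (Good.hits₁ p brs)
      one-flip (inj₁ (gb (pair d _ p _))) = inj₁ λ brs _ → deviate d (Good.hits₁ p brs)
      one-flip (inj₁ (bb p))              = inj₂ p
      one-flip (inj₂ (gy (pair d _ p _))) = inj₁ λ brs _ → deviate d (Good.hits₁ p brs)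
      one-flip (inj₂ (yy (pair d _ p _))) = inj₁ λ brs ag → deviate d (Chain.force p brs ag)
      one-flip (inj₂ (yb (pair d _ p _))) = inj₁ λ brs ag → deviate d (Chain.force p brs ag)
    ... | inj₁ hits = inj₁ (done F T ε′≤m (Chain.distinctT ch) T≤L hits)
    ... | inj₂ (w₁ , w₂ , z , perm , bz) = inj₂ (go (shape′ (here refl)) (shape′ (there (here refl))))
      where
      D≤ = ℕ.m+n≤o⇒m≤o (Frame.drops F ℕ.* L) DT≤
      shape′ : ∀ {t} → t ∈ w₁ ∷ w₂ ∷ z ∷ [] → Two F t ⊎ Mixed F R T t
      shape′ t∈ = shape (∈-resp-↭ (↭-sym perm) t∈)
      perm′ = ↭-trans perm (swap w₁ w₂ ↭-refl)
      z-bad = bb-bad F bz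
      commit : Lossy F R T w₁ → Lossy F R T w₂ → State (suc h) _
      commit p q = commit-step F ch D≤ h≤ p q z-bad perm big
      go : Two F w₁ ⊎ Mixed F R T w₁ → Two F w₂ ⊎ Mixed F R T w₂ → State (suc h) _
      -- Neither tree has an edge classified as leading into the chain, so the chain is forgotten
      -- with its clause and term, and the frame stays.
      go (inj₁ p)      (inj₁ q)      = assemble F 1≤L (proj₁ (slack (Frame.drops F) (ℕ.≤-trans D≤ h≤))) D≤
                                         (two-role F p) (two-role F q) z-bad perm big
      go (inj₁ (gg p)) (inj₂ q)      = continue F 1≤T T≤L DT≤ 1≤L D≤ q (gg-good F p) z-bad perm
      go (inj₁ (gb p)) (inj₂ q)      = commit (gb p) (mixed q)
      go (inj₁ (bb p)) (inj₂ q)      = commit (bb p) (mixed q)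
      go (inj₂ p)      (inj₁ (gg q)) = continue F 1≤T T≤L DT≤ 1≤L D≤ p (gg-good F q) z-bad perm′
      go (inj₂ p)      (inj₁ (gb q)) = commit (mixed p) (gb q)
      go (inj₂ p)      (inj₁ (bb q)) = commit (mixed p) (bb q)
      go (inj₂ p)      (inj₂ q)      = commit (mixed p) (mixed q)

    step : ∀ {h ts a b c} → State h ts → h ℕ.≤ suc n → All (Parent ts) (a ∷ b ∷ c ∷ []) →
      Big (a ∷ b ∷ c ∷ []) → Done (a ∷ b ∷ c ∷ []) ⊎ State (suc h) (a ∷ b ∷ c ∷ [])
    step {h} {ts} {a} {b} {c} (state F {g} {y} {z} g-good y-kind z-bad D≤ roles) h≤ parents big = go y-kind
      where
      open Frame F
      us = a ∷ b ∷ c ∷ []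
      child : ∀ {P : Tree n → Set} → P g → P y → P z → ∀ {t} → t ∈ ts → P t
      child pg py pz t∈ with ∈-resp-↭ roles t∈
      ... | here refl                 = pg
      ... | there (here refl)         = py
      ... | there (there (here refl)) = pz
      large : acceptance y ≤ m + e → ε′ ≤ m
      large y≤ = m-large F (proj₂ (slack drops (ℕ.≤-trans D≤ h≤))) (All.map cap parents) big
        where
        cap : ∀ {t} → Parent ts t → acceptance t ≤ m + e
        cap (parent {x} {c} x∉ c∈) = node-cap F {x} {c}
          (λ d → child {P = λ t → acceptance t ≤ m + e} (Good.bound g-good) y≤ (bad-≤ F z-bad) (c∈ d))
      two : Child₂ F y → ∀ {t} → t ∈ us → Two F t
      two y₂ t∈ with All.lookup parents t∈
      ... | parent x∉ c∈ = two-node F x∉ (λ d → child {P = Child₂ F} (G g-good) y₂ (B z-bad) (c∈ d))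
      three : ∀ {R T} → Chain F R T y → ∀ {t} → t ∈ us → Two F t ⊎ Mixed F R T t
      three {R} {T} ch t∈ with All.lookup parents t∈
      ... | parent x∉ c∈ = three-node F x∉ (λ d → child {P = Child₃ F R T} (G g-good) (Y ch) (B z-bad) (c∈ d))
      go : Second F h y → Done us ⊎ State (suc h) us
      go (good p)                = two-class-step F D≤ h≤ (two (G p)) (large (Good.bound p)) big
      go (chain ch 1≤T T≤L DT≤) = chain-step F ch 1≤T T≤L DT≤ h≤ (three ch) (large (chain-cap F ch)) big
      go (bad p)                 = two-class-step F D≤ h≤ (two (B p)) (large (bad-≤ F p)) big

    sink-step : ∀ {β₁ β₂ β₃} → let ts = leaf β₁ ∷ leaf β₂ ∷ leaf β₃ ∷ [] in Big ts → Done ts ⊎ State 1 ts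
    sink-step {β₁} {β₂} {β₃} big with pick {P = _≡ leaf true} {Q = _≡ leaf false} (accepts β₁ ∷ accepts β₂ ∷ accepts β₃ ∷ [])
      where
      accepts : ∀ β → leaf {n} β ≡ leaf true ⊎ leaf β ≡ leaf false
      accepts true  = inj₁ refl
      accepts false = inj₂ refl
    ... | inj₁ all = inj₁ (done empty-frame [] ε′≤1 [] z≤n (All.map (λ { refl _ _ → accept }) all))
      where
      ε′≤1 : ε′ ≤ 1ℚ
      ε′≤1 = m-large empty-frame (proj₂ (slack 0 z≤n)) (All.map (λ { refl → ≤-refl }) all) big
    ... | inj₂ (w₁ , w₂ , z , perm , refl) = inj₂ (assemble empty-frame 1≤L (proj₁ (slack 0 z≤n)) z≤n
          (role (here refl)) (role (there (here refl))) (mkBad ≤-refl) perm big)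
      where
      leaf-role : ∀ β → Role empty-frame (leaf β)
      leaf-role true  = good (record { hits₀ = λ _ → accept ; hits₁ = λ _ → accept ; uses = [] ; bound = ≤-refl })
      leaf-role false = bad (mkBad ≤-refl)
      role : ∀ {t} → t ∈ w₁ ∷ w₂ ∷ leaf false ∷ [] → Role empty-frame t
      role t∈ = All.lookup {P = Role empty-frame} (leaf-role β₁ ∷ leaf-role β₂ ∷ leaf-role β₃ ∷ []) (∈-resp-↭ (↭-sym perm) t∈)

    -- The index `suc (depth P)` counts the levels including the sinks. The three chosen nodes may
    -- coincide, which covers narrower levels.
    descend : ∀ {w} (P : Layers n w) → WidthLE 3 P → depth P ℕ.≤ n → ∀ u₁ u₂ u₃ →
      let us = u₁ ∷ u₂ ∷ u₃ ∷ [] ; ts = map (tree P) us in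
      All (λ u → ReadOnceTree (tree P u)) us → Big ts → Done ts ⊎ State (suc (depth P)) ts
    descend (sinks out) w≤ d≤ u₁ u₂ u₃ ro big = sink-step big
    descend (layer var next P) (w≤ , wP) d≤ u₁ u₂ u₃ (ro₁ ∷ ro₂ ∷ ro₃ ∷ []) big
      with cover (width≤ P wP) kids (here refl)
      where
      kids = next u₁ true ∷ next u₁ false ∷ next u₂ true ∷ next u₂ false ∷ next u₃ true ∷ next u₃ false ∷ []
    ... | v₁ , v₂ , v₃ , vs∈ , covered = finish (descend P wP (ℕ.≤-trans (ℕ.n≤1+n _) d≤) v₁ v₂ v₃ (All.map (All.lookup roKids) vs∈) (bigKids big))
      where
      vs = v₁ ∷ v₂ ∷ v₃ ∷ []
      roKids : All (λ v → ReadOnceTree (tree P v)) (next u₁ true ∷ next u₁ false ∷ next u₂ true ∷ next u₂ false ∷ next u₃ true ∷ next u₃ false ∷ [])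
      roKids = proj₂ (ro₁ true) ∷ proj₂ (ro₁ false) ∷ proj₂ (ro₂ true) ∷ proj₂ (ro₂ false) ∷ proj₂ (ro₃ true) ∷ proj₂ (ro₃ false) ∷ []
      kid₁ : ∀ d → next u₁ d ∈ vs
      kid₁ true  = covered (here refl)
      kid₁ false = covered (there (here refl))
      kid₂ : ∀ d → next u₂ d ∈ vs
      kid₂ true  = covered (there (there (here refl)))
      kid₂ false = covered (there (there (there (here refl))))
      kid₃ : ∀ d → next u₃ d ∈ vs
      kid₃ true  = covered (there (there (there (there (here refl)))))
      kid₃ false = covered (there (there (there (there (there (here refl))))))
      big-child : ∀ {x c} → (∀ d → c d ∈ map (tree P) vs) → ε ≤ acceptance (node x c) → Big (map (tree P) vs)
      big-child {c = c} c∈ ε≤ with average-big ε≤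
      ... | inj₁ ε≤t = c true , c∈ true , ε≤t
      ... | inj₂ ε≤f = c false , c∈ false , ε≤f
      parents : All (Parent (map (tree P) vs)) (map (tree (layer var next P)) (u₁ ∷ u₂ ∷ u₃ ∷ []))
      parents = parent (proj₁ ∘ ro₁) (∈-map⁺ (tree P) ∘ kid₁)
              ∷ parent (proj₁ ∘ ro₂) (∈-map⁺ (tree P) ∘ kid₂)
              ∷ parent (proj₁ ∘ ro₃) (∈-map⁺ (tree P) ∘ kid₃) ∷ []
      bigKids : Big _ → Big (map (tree P) vs)
      bigKids (t , t∈ , ε≤) with All.lookup parents t∈
      ... | parent {x} {c} _ c∈ = big-child {x} {c} c∈ ε≤
      finish : Done (map (tree P) vs) ⊎ State (suc (depth P)) (map (tree P) vs) → _
      finish (inj₁ dn) = inj₁ (Done-parents dn parents)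
      finish (inj₂ st) = step st (ℕ.m≤n⇒m≤1+n d≤) parents big

    -- All three trees are copies of the source. A `State` would declare one copy bad, too little
    -- for acceptance `ε`, so the descent ends in `Done`.
    source-done : (P : BP n) → WidthLE 3 P → depth P ℕ.≤ n → let s = tree P zero in
      ReadOnceTree s → ε ≤ acceptance s → Done (s ∷ s ∷ s ∷ [])
    source-done P w≤ d≤ ro ε≤ with descend P w≤ d≤ zero zero zero (ro ∷ ro ∷ ro ∷ []) big
      where big = _ , here refl , ε≤
    ... | inj₁ dn = dn
    ... | inj₂ (state F g y b D≤ roles) = ⊥-elim (capped⊥ F (proj₁ (slack (Frame.drops F) (ℕ.≤-trans D≤ (s≤s d≤)))) {tree P zero ∷ []}
            (s-cap ∷ []) (_ , here refl , ε≤))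
      where
      only : ∀ {t s : Tree n} → t ∈ s ∷ s ∷ s ∷ [] → t ≡ s
      only (here eq)                 = eq
      only (there (here eq))         = eq
      only (there (there (here eq))) = eq
      s-cap : acceptance (tree P zero) ≤ + 13 / 16 + Frame.e F
      s-cap = subst (λ t → acceptance t ≤ + 13 / 16 + Frame.e F)
        (only (∈-resp-↭ (↭-sym roles) (there (there (here refl))))) (bad-cap F b)

-- Smallness of the error for long inputs.

ℕtoℚ-mono : ∀ {a b} → a ℕ.≤ b → ℕtoℚ a ≤ ℕtoℚ b
ℕtoℚ-mono {a} {b} a≤b = subst₂ _≤_ (+-identityʳ (ℕtoℚ a))
  (trans (sym (ℕtoℚ-+ a (b ℕ.∸ a))) (cong ℕtoℚ (ℕ.m+[n∸m]≡n a≤b)))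
  (+-monoʳ-≤ (ℕtoℚ a) (nonneg (b ℕ.∸ a)))
  where
  nonneg : ∀ k → 0ℚ ≤ ℕtoℚ k
  nonneg zero    = ≤-refl
  nonneg (suc k) = subst (0ℚ ≤_) (sym (ℕtoℚ-+ 1 k)) (0≤+ {ℕtoℚ 1} (toWitness {a? = 0ℚ ≤? ℕtoℚ 1} _) (nonneg k))

ℕtoℚ-positive : ∀ k .{{_ : ℕ.NonZero k}} → Positive (ℕtoℚ k)
ℕtoℚ-positive k@(suc _) = positive (<-≤-trans (toWitness {a? = 0ℚ <? ℕtoℚ 1} _) (ℕtoℚ-mono {1} {k} (s≤s z≤n)))

pow2inv-inverse : ∀ L → ℕtoℚ (2 ℕ.^ L) * pow2inv L ≡ 1ℚ
pow2inv-inverse zero    = refl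
pow2inv-inverse (suc L) = trans (cong (_* (½ * pow2inv L)) (trans (cong (λ k → ℕtoℚ (p ℕ.+ k)) (ℕ.+-identityʳ p)) (ℕtoℚ-+ p p)))
  (trans (solve 2 (λ p q → (p :+ p) :* (con ½ :* q) := p :* q) refl (ℕtoℚ p) (pow2inv L)) (pow2inv-inverse L))
  where p = 2 ℕ.^ L

multiple-error : ∀ L k D → ℕtoℚ k * error L D ≡ ℕtoℚ (D ℕ.* k) * pow2inv L
multiple-error L k zero    = trans (*-zeroʳ (ℕtoℚ k)) (sym (*-zeroˡ (pow2inv L)))
multiple-error L k (suc D) = begin
  K * (p + E)                          ≡⟨ *-distribˡ-+ K p E ⟩
  K * p + K * E                        ≡⟨ cong (λ q → K * p + q) (multiple-error L k D) ⟩
  K * p + ℕtoℚ (D ℕ.* k) * p           ≡⟨ sym (*-distribʳ-+ p K (ℕtoℚ (D ℕ.* k))) ⟩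
  (K + ℕtoℚ (D ℕ.* k)) * p             ≡⟨ cong (_* p) (sym (ℕtoℚ-+ k (D ℕ.* k))) ⟩
  ℕtoℚ (suc D ℕ.* k) * p               ∎
  where
  open ≡-Reasoning
  K = ℕtoℚ k
  p = pow2inv L
  E = error L D

n<2^[1+⌊log₂n⌋] : ∀ n → n ℕ.< 2 ℕ.^ suc ⌊log₂ n ⌋
n<2^[1+⌊log₂n⌋] n with n ℕ.<? 2 ℕ.^ suc ⌊log₂ n ⌋
... | yes n< = n<
... | no  n≮ = contradiction
  (subst (ℕ._≤ ⌊log₂ n ⌋) (⌊log₂[2^n]⌋≡n (suc ⌊log₂ n ⌋)) (⌊log₂⌋-mono-≤ (ℕ.≮⇒≥ n≮))) (ℕ.<⇒≱ ℕ.≤-refl)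

-- Multiplied by its denominator, a positive rational becomes its numerator.
archimedean : ∀ δ → 0ℚ < δ → 1ℚ ≤ ℕtoℚ (↧ₙ δ) * δ
archimedean δ 0<δ = toℚᵘ-cancel-≤ (begin
  toℚᵘ 1ℚ                                  ≤⟨ bound δ {{positive 0<δ}} ⟩
  ℚᵘ.mkℚᵘ (+ ↧ₙ δ) 0 ℚᵘ.* toℚᵘ δ           ≃⟨ ℚᵘ.*-congʳ (ℚᵘ.≃-sym (toℚᵘ-fromℚᵘ (ℚᵘ.mkℚᵘ (+ ↧ₙ δ) 0))) ⟩
  toℚᵘ (ℕtoℚ (↧ₙ δ)) ℚᵘ.* toℚᵘ δ           ≃⟨ ℚᵘ.≃-sym (toℚᵘ-homo-* (ℕtoℚ (↧ₙ δ)) δ) ⟩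
  toℚᵘ (ℕtoℚ (↧ₙ δ) * δ)                   ∎)
  where
  open ℚᵘ.≤-Reasoning
  bound : ∀ δ .{{_ : Positive δ}} → toℚᵘ 1ℚ ℚᵘ.≤ ℚᵘ.mkℚᵘ (+ ↧ₙ δ) 0 ℚᵘ.* toℚᵘ δ
  bound (mkℚ (+ suc p) d _) = ℚᵘ.*≤* (ℤ.+≤+ (subst₂ ℕ._≤_
    (cong suc (sym (trans (ℕ.+-identityʳ (d ℕ.+ 0)) (ℕ.+-identityʳ d))))
    (sym (ℕ.*-identityʳ (suc d ℕ.* suc p)))
    (ℕ.m≤m*n (suc d) (suc p))))

error-small : ∀ L k .{{_ : ℕ.NonZero k}} D δ → 1ℚ ≤ ℕtoℚ k * δ → D ℕ.* k ℕ.≤ 2 ℕ.^ L → error L D ≤ δ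
error-small L k D δ 1≤kδ Dk≤ = *-cancelˡ-≤-pos (ℕtoℚ k) {{ℕtoℚ-positive k}} (begin
  ℕtoℚ k * error L D                ≡⟨ multiple-error L k D ⟩
  ℕtoℚ (D ℕ.* k) * pow2inv L        ≤⟨ *-monoʳ-≤-nonNeg (pow2inv L) {{nonNegative (pow2inv-nonneg L)}} (ℕtoℚ-mono Dk≤) ⟩
  ℕtoℚ (2 ℕ.^ L) * pow2inv L        ≡⟨ pow2inv-inverse L ⟩
  1ℚ                                ≤⟨ 1≤kδ ⟩
  ℕtoℚ k * δ                        ∎)
  where open ≤-Reasoning

-- With `L` the rounded logarithm, 2Dk ≤ DL ≤ n + 1 ≤ 2^(L+1). So the roughly n / log n drops, each
-- costing about 1 / n, have a total error that tends to 0.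
few-drops : ∀ {n k D} → 2 ℕ.* k ℕ.≤ ⌊log₂ n ⌋ → D ℕ.* ⌊log₂ n ⌋ ℕ.≤ suc n → D ℕ.* k ℕ.≤ 2 ℕ.^ ⌊log₂ n ⌋
few-drops {n} {k} {D} 2k≤L DL≤ = ℕ.*-cancelˡ-≤ 2 (begin
  2 ℕ.* (D ℕ.* k)          ≡⟨ ℕS.solve 2 (λ D k → ℕS.con 2 ℕS.:* (D ℕS.:* k) ℕS.:= D ℕS.:* (ℕS.con 2 ℕS.:* k)) refl D k ⟩
  D ℕ.* (2 ℕ.* k)          ≤⟨ ℕ.*-monoʳ-≤ D 2k≤L ⟩
  D ℕ.* ⌊log₂ n ⌋          ≤⟨ DL≤ ⟩
  suc n                    ≤⟨ n<2^[1+⌊log₂n⌋] n ⟩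
  2 ℕ.* 2 ℕ.^ ⌊log₂ n ⌋    ∎)
  where open ℕ.≤-Reasoning

hit-at-length : ∀ {n ε ε' A} → let L = ⌊log₂ n ⌋ in 1 ℕ.≤ L →
  (∀ D → D ℕ.* L ℕ.≤ suc n → (+ 13 / 16 + error L D < ε) × (ε' + error L D ≤ ε)) →
  RichAt (powℚ ε' 11) A n → (P : BP n) → ROBP3 P → ε * ℕtoℚ (2 ℕ.^ n) ≤ ℕtoℚ (numSat (eval P)) →
  ∃ λ (a : Word n) → Ω 3 A n a × eval P a ≡ true
hit-at-length {n} {ε} {ε'} {A} 1≤L slack rich P (once , width) many = conclude
  (rich-literals {A = A} rich clauses term distinct nonempty term≤ weight≥)
  where
  open Descent {n} ⌊log₂ n ⌋ ε ε'
  s = tree P zero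

  ro : ReadOnceTree s
  ro = unique⇒readOnce s λ a → subst Unique (sym (queries-tree P zero a)) (once a)

  depth≤ : depth P ℕ.≤ n
  depth≤ = subst (ℕ._≤ n) (length-queried P zero (const false)) (unique-length _ (once (const false)))

  ε≤ : ε ≤ acceptance s
  ε≤ = *-cancelˡ-≤-pos (ℕtoℚ (2 ℕ.^ n)) {{ℕtoℚ-positive (2 ℕ.^ n) {{ℕ.m^n≢0 2 n}}}}
    (subst₂ _≤_ (*-comm ε (ℕtoℚ (2 ℕ.^ n)))
      (trans (cong ℕtoℚ (numSat-cong λ a → sym (run-tree P zero a))) (numSat-run s ro)) many)

  open Done (source-done 1≤L slack P width depth≤ ro ε≤)

  conclude : (∃ λ a → A n a × All (Breaks a) clauses × Agrees a term) →
    ∃ λ b → Ω 3 A n b × eval P b ≡ true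
  conclude (a , a∈A , breaks , agrees) with Hits⇒run s ro (hits breaks agrees (here refl))
  ... | b , run≡ , close , _ = b , (a , a∈A , ℕ.≤-trans close (ℕ.n≤1+n 2)) , trans (sym (run-tree P zero b)) run≡

-- `δ₁` is the room for error between 13/16 and `ε`, `δ₂` that between `ε'` and `ε`; `k₁` and `k₂`
-- stand for their reciprocals.
hitting : ∀ {ε ε' A} k₁ k₂ .{{_ : ℕ.NonZero k₁}} .{{_ : ℕ.NonZero k₂}} δ₁ δ₂ →
  1ℚ ≤ ℕtoℚ k₁ * δ₁ → 1ℚ ≤ ℕtoℚ k₂ * δ₂ → + 13 / 16 + δ₁ < ε → ε' + δ₂ ≤ ε →
  Rich (powℚ ε' 11) A → HittingROBP3 ε (Ω 3 A)
hitting {ε} {ε'} {A} k₁@(suc _) k₂ δ₁ δ₂ 1≤k₁δ₁ 1≤k₂δ₂ gap close (N₀ , rich) =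
  -- From this length on the logarithm is at least 2(`k₁` + `k₂`), and the sum serves both error
  -- bounds at once.
  N₀ ℕ.+ 2 ℕ.^ (2 ℕ.* (k₁ ℕ.+ k₂)) , λ n N≤n P → hit-at-length {n} {ε} {ε'} {A} (1≤L n N≤n) (slack n N≤n) (rich n (ℕ.m+n≤o⇒m≤o N₀ N≤n)) P
  where
  k = k₁ ℕ.+ k₂
  module _ (n : ℕ) (N≤n : N₀ ℕ.+ 2 ℕ.^ (2 ℕ.* k) ℕ.≤ n) where
    L = ⌊log₂ n ⌋

    2k≤L : 2 ℕ.* k ℕ.≤ L
    2k≤L = subst (ℕ._≤ L) (⌊log₂[2^n]⌋≡n (2 ℕ.* k)) (⌊log₂⌋-mono-≤ (ℕ.m+n≤o⇒n≤o N₀ N≤n))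

    1≤L : 1 ℕ.≤ L
    1≤L = ℕ.≤-trans (s≤s z≤n) 2k≤L

    slack : ∀ D → D ℕ.* L ℕ.≤ suc n → (+ 13 / 16 + error L D < ε) × (ε' + error L D ≤ ε)
    slack D DL≤ =
      ≤-<-trans (+-monoʳ-≤ (+ 13 / 16) (error-small L k₁ D δ₁ 1≤k₁δ₁
        (ℕ.≤-trans (ℕ.*-monoʳ-≤ D (ℕ.m≤m+n k₁ k₂)) Dk≤))) gap ,
      ≤-trans (+-monoʳ-≤ ε' (error-small L k₂ D δ₂ 1≤k₂δ₂
        (ℕ.≤-trans (ℕ.*-monoʳ-≤ D (ℕ.m≤n+m k₂ k₁)) Dk≤))) close
      where
      Dk≤ : D ℕ.* k ℕ.≤ 2 ℕ.^ L
      Dk≤ = few-drops {n} {k} {D} 2k≤L DL≤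

theorem1 : (ε : ℚ) → + 5 / 6 < ε → (A : Lang) → (ε' : ℚ) → ε' < ε →
    Rich (powℚ ε' 11) A → HittingROBP3 ε (Ω 3 A)
-- 13/16 + 1/48 = 5/6.
theorem1 ε 5/6<ε A ε' ε'<ε rich = hitting {ε} {ε'} {A} (↧ₙ (+ 1 / 48)) (↧ₙ (ε - ε')) (+ 1 / 48) (ε - ε')
  (archimedean (+ 1 / 48) (toWitness {a? = 0ℚ <? (+ 1 / 48)} _)) (archimedean (ε - ε') 0<δ)
  5/6<ε (≤-reflexive (solve 2 (λ ε ε' → ε' :+ (ε :- ε') := ε) refl ε ε')) rich
  where
  0<δ : 0ℚ < ε - ε'
  0<δ = subst (_< ε - ε') (+-inverseʳ ε') (+-monoˡ-< (- ε') ε'<ε)
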